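{- Let $b, c$ be integers satisfying $-3 \le b \le 0$ and $c \ge -b+1$. Then $\mathbb{Q}(\alpha) \neq \mathbb{Q}(\beta)$ holds for all $\alpha, \beta \in I_{b,c}^{3,ntr}$ with $\alpha \neq \beta$.
   Context: For integers $m, n$ satisfying $m^2-3n \le 0$ and $m+n \ge 1$, define $$I_{m,n}^{3,ntr} := \{\alpha \in (0,1) \mid \alpha^3+m\alpha^2+n\alpha+d=0 \text{ for some } d \in \mathbb{Z},\ -(m+n) \le d \le -1\}.$$ $\mathbb{Q}(\alpha)$ denotes the subfield of $\mathbb{C}$ generated by $\alpha$. -}

module Defs where

open import Algebra.Bundles.Raw using (RawRing)
open import Data.Integer as ℤ using (ℤ; -1ℤ)
open import Data.Nat as ℕ using (ℕ)
import Data.Nat.Properties as ℕ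
open import Data.Product using (_×_; _,_; ∃-syntax; Σ-syntax)
open import Data.Rational as ℚ using (ℚ; 0ℚ; 1ℚ; ½; Positive; ∣_∣)
open import Data.Rational.Properties
open import Data.Rational.Solver using (module +-*-Solver)
open import Level using (0ℓ)
open import Relation.Binary.PropositionalEquality using (_≡_; refl; sym; cong; subst)
open import Relation.Unary using (Pred)

open +-*-Solver using (solve; _:+_; _:*_; :-_; _:-_; _:=_; con)

-- The real numbers: Cauchy sequences of rationals, with two sequences
-- identified (via _≈_) when their difference tends to zero.

IsCauchy : Pred (ℕ → ℚ) 0ℓ
IsCauchy f = ∀ ε → 0ℚ ℚ.< ε →
  ∃[ N ] (∀ m n → N ℕ.≤ m → N ℕ.≤ n → ∣ f m ℚ.- f n ∣ ℚ.< ε)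

record ℝ : Set where
  constructor mkℝ
  field
    seq    : ℕ → ℚ
    cauchy : IsCauchy seq

open ℝ public

infix 4 _≈_ _<_

_≈_ : ℝ → ℝ → Set
x ≈ y = ∀ ε → 0ℚ ℚ.< ε → ∃[ N ] (∀ n → N ℕ.≤ n → ∣ seq x n ℚ.- seq y n ∣ ℚ.< ε)

-- A uniform gap ε is required: eventual termwise inequality alone would not
-- give a strict inequality between the limits.

_<_ : ℝ → ℝ → Set
x < y = ∃[ ε ] (0ℚ ℚ.< ε × ∃[ N ] (∀ n → N ℕ.≤ n → seq x n ℚ.+ ε ℚ.< seq y n))

private

  half-pos : ∀ {ε} → 0ℚ ℚ.< ε → 0ℚ ℚ.< ½ ℚ.* ε
  half-pos {ε} 0<ε = subst (ℚ._< ½ ℚ.* ε) (*-zeroʳ ½) (*-monoʳ-<-pos ½ 0<ε)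

  halves : ∀ ε → ½ ℚ.* ε ℚ.+ ½ ℚ.* ε ≡ ε
  halves = solve 1 (λ e → con ½ :* e :+ con ½ :* e := e) refl

  ∣p+q∣<ε : ∀ p q ε → ∣ p ∣ ℚ.< ½ ℚ.* ε → ∣ q ∣ ℚ.< ½ ℚ.* ε → ∣ p ℚ.+ q ∣ ℚ.< ε
  ∣p+q∣<ε p q ε p< q< = subst (∣ p ℚ.+ q ∣ ℚ.<_) (halves ε)
    (≤-<-trans (∣p+q∣≤∣p∣+∣q∣ p q) (+-mono-< p< q<))

  bounded : ∀ {f} → IsCauchy f →
            ∃[ B ] (Positive B × ∃[ N ] (∀ n → N ℕ.≤ n → ∣ f n ∣ ℚ.≤ B))
  bounded {f} f-cauchy with f-cauchy 1ℚ (positive⁻¹ 1ℚ)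
  ... | N , close = 1ℚ ℚ.+ ∣ f N ∣
                  , pos+nonNeg⇒pos 1ℚ ∣ f N ∣ {{∣-∣-nonNeg (f N)}}
                  , N
                  , λ n N≤n → begin
    ∣ f n ∣                       ≡⟨ cong ∣_∣ (split (f n) (f N)) ⟩
    ∣ (f n ℚ.- f N) ℚ.+ f N ∣     ≤⟨ ∣p+q∣≤∣p∣+∣q∣ (f n ℚ.- f N) (f N) ⟩
    ∣ f n ℚ.- f N ∣ ℚ.+ ∣ f N ∣   ≤⟨ +-monoˡ-≤ ∣ f N ∣ (<⇒≤ (close n N N≤n ℕ.≤-refl)) ⟩
    1ℚ ℚ.+ ∣ f N ∣                ∎
    where
    open ≤-Reasoning
    split : ∀ p q → p ≡ (p ℚ.- q) ℚ.+ q
    split = solve 2 (λ p q → p := (p :- q) :+ q) refl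

  -- A factor bounded by B times a factor below scale B ε is below ε.

  scale : ∀ B → .{{Positive B}} → ℚ → ℚ
  scale B ε = (ℚ.1/ B) {{pos⇒nonZero B}} ℚ.* ε

  scale-pos : ∀ B .{{_ : Positive B}} {ε} → 0ℚ ℚ.< ε → 0ℚ ℚ.< scale B ε
  scale-pos B {ε} 0<ε = subst (ℚ._< scale B ε) (*-zeroʳ 1/B)
    (*-monoʳ-<-pos 1/B {{1/pos⇒pos B}} 0<ε)
    where
    1/B : ℚ
    1/B = (ℚ.1/ B) {{pos⇒nonZero B}}

  ∣p*q∣<ε : ∀ B .{{_ : Positive B}} p q ε →
            ∣ p ∣ ℚ.≤ B → ∣ q ∣ ℚ.< scale B ε → ∣ p ℚ.* q ∣ ℚ.< ε
  ∣p*q∣<ε B p q ε p≤ q< = begin-strict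
    ∣ p ℚ.* q ∣           ≡⟨ ∣p*q∣≡∣p∣*∣q∣ p q ⟩
    ∣ p ∣ ℚ.* ∣ q ∣       ≤⟨ *-monoʳ-≤-nonNeg ∣ q ∣ {{∣-∣-nonNeg q}} p≤ ⟩
    B ℚ.* ∣ q ∣           <⟨ *-monoʳ-<-pos B q< ⟩
    B ℚ.* scale B ε       ≡⟨ *-assoc B 1/B ε ⟨
    B ℚ.* 1/B ℚ.* ε       ≡⟨ cong (ℚ._* ε) (*-inverseʳ B {{pos⇒nonZero B}}) ⟩
    1ℚ ℚ.* ε              ≡⟨ *-identityˡ ε ⟩
    ε                     ∎
    where
    open ≤-Reasoning
    1/B : ℚ
    1/B = (ℚ.1/ B) {{pos⇒nonZero B}}

fromℚ : ℚ → ℝ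
fromℚ q = mkℝ (λ _ → q) λ ε 0<ε →
  0 , λ _ _ _ _ → subst (ℚ._< ε) (cong ∣_∣ (sym (+-inverseʳ q))) 0<ε

fromℤ : ℤ → ℝ
fromℤ i = fromℚ (i ℚ./ 1)

infix  8 -_
infixl 7 _*_
infixl 6 _+_

_+_ : ℝ → ℝ → ℝ
mkℝ f f-cauchy + mkℝ g g-cauchy = mkℝ (λ n → f n ℚ.+ g n) sum-cauchy
  where
  regroup : ∀ a b c d → (a ℚ.- c) ℚ.+ (b ℚ.- d) ≡ (a ℚ.+ b) ℚ.- (c ℚ.+ d)
  regroup = solve 4 (λ a b c d → (a :- c) :+ (b :- d) := (a :+ b) :- (c :+ d)) refl

  sum-cauchy : IsCauchy (λ n → f n ℚ.+ g n)
  sum-cauchy ε 0<ε with f-cauchy (½ ℚ.* ε) (half-pos 0<ε) | g-cauchy (½ ℚ.* ε) (half-pos 0<ε)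
  ... | M , f-close | N , g-close = M ℕ.⊔ N , λ m n M⊔N≤m M⊔N≤n →
    subst (λ r → ∣ r ∣ ℚ.< ε) (regroup (f m) (g m) (f n) (g n))
      (∣p+q∣<ε (f m ℚ.- f n) (g m ℚ.- g n) ε
        (f-close m n (ℕ.m⊔n≤o⇒m≤o M N M⊔N≤m) (ℕ.m⊔n≤o⇒m≤o M N M⊔N≤n))
        (g-close m n (ℕ.m⊔n≤o⇒n≤o M N M⊔N≤m) (ℕ.m⊔n≤o⇒n≤o M N M⊔N≤n)))

-_ : ℝ → ℝ
- mkℝ f f-cauchy = mkℝ (λ n → ℚ.- f n) neg-cauchy
  where
  swap : ∀ a b → b ℚ.- a ≡ (ℚ.- a) ℚ.- (ℚ.- b)
  swap = solve 2 (λ a b → b :- a := (:- a) :- (:- b)) refl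

  neg-cauchy : IsCauchy (λ n → ℚ.- f n)
  neg-cauchy ε 0<ε with f-cauchy ε 0<ε
  ... | N , close = N , λ m n N≤m N≤n →
    subst (λ r → ∣ r ∣ ℚ.< ε) (swap (f m) (f n)) (close n m N≤n N≤m)

_*_ : ℝ → ℝ → ℝ
mkℝ f f-cauchy * mkℝ g g-cauchy = mkℝ (λ n → f n ℚ.* g n) product-cauchy
  where
  regroup : ∀ a b c d → a ℚ.* (b ℚ.- d) ℚ.+ d ℚ.* (a ℚ.- c) ≡ a ℚ.* b ℚ.- c ℚ.* d
  regroup = solve 4 (λ a b c d → a :* (b :- d) :+ d :* (a :- c) := a :* b :- c :* d) refl

  product-cauchy : IsCauchy (λ n → f n ℚ.* g n)
  product-cauchy ε 0<ε =
    let A , A-pos , K , f≤A = bounded f-cauchy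
        B , B-pos , L , g≤B = bounded g-cauchy
        M , f-close = f-cauchy (scale B {{B-pos}} (½ ℚ.* ε)) (scale-pos B {{B-pos}} (half-pos 0<ε))
        N , g-close = g-cauchy (scale A {{A-pos}} (½ ℚ.* ε)) (scale-pos A {{A-pos}} (half-pos 0<ε))
    in (K ℕ.⊔ L) ℕ.⊔ (M ℕ.⊔ N) , λ m n ≤m ≤n →
    let KL≤m = ℕ.m⊔n≤o⇒m≤o (K ℕ.⊔ L) (M ℕ.⊔ N) ≤m
        KL≤n = ℕ.m⊔n≤o⇒m≤o (K ℕ.⊔ L) (M ℕ.⊔ N) ≤n
        MN≤m = ℕ.m⊔n≤o⇒n≤o (K ℕ.⊔ L) (M ℕ.⊔ N) ≤m
        MN≤n = ℕ.m⊔n≤o⇒n≤o (K ℕ.⊔ L) (M ℕ.⊔ N) ≤n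
    in subst (λ r → ∣ r ∣ ℚ.< ε) (regroup (f m) (g m) (f n) (g n))
      (∣p+q∣<ε (f m ℚ.* (g m ℚ.- g n)) (g n ℚ.* (f m ℚ.- f n)) ε
        (∣p*q∣<ε A {{A-pos}} (f m) (g m ℚ.- g n) (½ ℚ.* ε)
          (f≤A m (ℕ.m⊔n≤o⇒m≤o K L KL≤m))
          (g-close m n (ℕ.m⊔n≤o⇒n≤o M N MN≤m) (ℕ.m⊔n≤o⇒n≤o M N MN≤n)))
        (∣p*q∣<ε B {{B-pos}} (g n) (f m ℚ.- f n) (½ ℚ.* ε)
          (g≤B n (ℕ.m⊔n≤o⇒n≤o K L KL≤n))
          (f-close m n (ℕ.m⊔n≤o⇒m≤o M N MN≤m) (ℕ.m⊔n≤o⇒m≤o M N MN≤n))))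

0ℝ 1ℝ : ℝ
0ℝ = fromℚ 0ℚ
1ℝ = fromℚ 1ℚ

ℝ-rawRing : RawRing 0ℓ 0ℓ
ℝ-rawRing = record
  { Carrier = ℝ ; _≈_ = _≈_ ; _+_ = _+_ ; _*_ = _*_ ; -_ = -_ ; 0# = 0ℝ ; 1# = 1ℝ }

open RawRing ℝ-rawRing public using (_≉_)
open import Algebra.Definitions.RawSemiring (RawRing.rawSemiring ℝ-rawRing) public using (_^_)

record ℂ : Set where
  constructor _+i_
  field
    re im : ℝ

open ℂ public

ℂ-rawRing : RawRing 0ℓ 0ℓ
ℂ-rawRing = record
  { Carrier = ℂ
  ; _≈_ = λ z w → re z ≈ re w × im z ≈ im w
  ; _+_ = λ z w → (re z + re w) +i (im z + im w)
  ; _*_ = λ z w → (re z * re w + - (im z * im w)) +i (re z * im w + im z * re w)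
  ; -_  = λ z → (- re z) +i (- im z)
  ; 0#  = 0ℝ +i 0ℝ
  ; 1#  = 1ℝ +i 0ℝ
  }

module ℂᵣ = RawRing ℂ-rawRing

fromℝ : ℝ → ℂ
fromℝ x = x +i 0ℝ

-- ℚ⟨ γ ⟩ is the subfield of ℂ generated by γ.  Every subfield contains ℚ, so
-- no constructor for rational numbers is needed.  The closure under ≈ is
-- there because elements of ℂ are representatives, not equivalence classes.

data ℚ⟨_⟩ (γ : ℂ) : Pred ℂ 0ℓ where
  generator : ℚ⟨ γ ⟩ γ
  zero      : ℚ⟨ γ ⟩ ℂᵣ.0#
  one       : ℚ⟨ γ ⟩ ℂᵣ.1#
  add       : ∀ {z w} → ℚ⟨ γ ⟩ z → ℚ⟨ γ ⟩ w → ℚ⟨ γ ⟩ (z ℂᵣ.+ w)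
  negate    : ∀ {z} → ℚ⟨ γ ⟩ z → ℚ⟨ γ ⟩ (ℂᵣ.- z)
  multiply  : ∀ {z w} → ℚ⟨ γ ⟩ z → ℚ⟨ γ ⟩ w → ℚ⟨ γ ⟩ (z ℂᵣ.* w)
  invert    : ∀ {z w} → ℚ⟨ γ ⟩ z → z ℂᵣ.* w ℂᵣ.≈ ℂᵣ.1# → ℚ⟨ γ ⟩ w
  respects  : ∀ {z w} → z ℂᵣ.≈ w → ℚ⟨ γ ⟩ z → ℚ⟨ γ ⟩ w

I³ⁿᵗʳ : ℤ → ℤ → Pred ℝ 0ℓ
I³ⁿᵗʳ m n α =
  (0ℝ < α × α < 1ℝ) ×
  Σ[ d ∈ ℤ ] (ℤ.- (m ℤ.+ n) ℤ.≤ d × d ℤ.≤ -1ℤ ×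
    α ^ 3 + fromℤ m * α ^ 2 + fromℤ n * α + fromℤ d ≈ 0ℝ)

{-# OPTIONS --safe #-}

-- Let f, g = X³ + bX² + cX + d, X³ + bX² + cX + e have the zeros α, β in (0, 1),
-- and suppose β ∈ ℚ(α).  Both zeros are irrational, and ℚ(α) has one real embedding
-- and a pair of complex ones, which send α to α′ = -(b + α)/2 ± i √D(α)/2 with
-- D(x) = 4c - b² + 2bx + 3x² ≥ 4, and likewise for β.  For integers p, q, k the number
-- γ = pα + qβ + k is an algebraic integer, so its norm γ |γ′|² is an integer.
--
-- Up to sign Im β′ / Im α′ is √(D(β)/D(α)).  If this ratio is positive then δ = α - β
-- has |δ′|² = (δ² + (√D(α) - √D(β))²)/4, which is less than 1 as D(α) - D(β) =
-- δ (2b + 3(α + β)); hence the norm of δ is 0 and α = β.  If it is negative, the same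
-- estimate applies to the imaginary part of α + β.  For b = -1 and b = -2 the number
-- ±(α + β - 1) has norm less than 1 in absolute value, hence is 0, which is impossible
-- as its trace is odd.  For b = 0 and b = -3 the number γ = α + β or γ = 2 - α - β has
-- norm strictly between 0 and 2, hence 1, and this forces the norm of 1 - γ into the
-- interval (-2, -1).
module Submission where

open import Algebra.Bundles using (CommutativeRing)
import Algebra.Solver.Ring as RingSolver
open import Algebra.Solver.Ring.AlmostCommutativeRing
  using (fromCommutativeRing; _-Raw-AlmostCommutative⟶_)
open import Data.Empty using (⊥; ⊥-elim)
open import Data.Integer as ℤ using (ℤ; +_; -[1+_]; 0ℤ; 1ℤ; -1ℤ; -≤-; +≤+)
import Data.Integer.Properties as ℤ
import Data.Maybe as Maybe
open import Data.Nat as ℕ using (ℕ; zero; suc)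
open import Data.Nat.Coprimality as Coprimality using (Coprime; coprime-divisor)
import Data.Nat.Divisibility as ℕ
import Data.Nat.Properties as ℕ
open import Data.Product using (_×_; _,_; proj₁; proj₂; ∃-syntax)
open import Data.Rational as ℚ using (ℚ; 0ℚ; 1ℚ; ½; ∣_∣; Positive; ↥_; ↧_)
import Data.Rational.Properties as ℚ
open import Data.Rational.Solver using (module +-*-Solver)
import Data.Rational.Unnormalised as ℚᵘ
import Data.Rational.Unnormalised.Properties as ℚᵘ
open import Data.Sum using (inj₁; inj₂; [_,_]′)
open import Level using (0ℓ)
open import Relation.Binary.Definitions using (WeaklyDecidable; tri<; tri≈; tri>)
open import Relation.Binary.PropositionalEquality as ≡ using (_≡_; _≢_; cong; subst; subst₂)
import Relation.Binary.Reasoning.Setoid as SetoidReasoning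
open import Relation.Nullary using (¬_; contradiction; Dec; yes; no)
open import Relation.Nullary.Decidable using (dec⇒maybe)
open import Relation.Unary using (Pred; _∈_; _≐_)

-- Arithmetic of ℕ and ℚ

-- Signs of real numbers cannot be decided, so sign distinctions are confined to goals that are `⊥`
-- or stable. Hence the double negations, which cost nothing because the theorem is itself a
-- negation. No complex number and no square root enters the estimates. The complex embedding is
-- recorded by real coordinates with respect to 1 and X modulo X² + P X + Q. The coordinate of β at
-- X is a real number whose square is D(β)/D(α); its sign decides between α - β and α + β.
-- Integrality of the norm of γ does not come from a monic equation for γ, but from a common
-- denominator of all powers of γ. The substitution x ↦ 1 - x exchanges b with -3 - b and α + β with
-- 2 - α - β, and it preserves the condition c ≥ 1 - b. This pairs the cases b = 0, -3 and b = -1,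
-- -2. In the first pair γ ranges over (0, 2) and not over (-1, 1), so smallness of its norm leaves
-- the value 1 open, and a second element is needed to exclude it.

toℚᵘ-/1 : ∀ i → ℚ.toℚᵘ (i ℚ./ 1) ℚᵘ.≃ ℚᵘ.mkℚᵘ i 0
toℚᵘ-/1 i = ℚ.toℚᵘ-fromℚᵘ (ℚᵘ.mkℚᵘ i 0)

/1-homo-+ : ∀ i j → (i ℤ.+ j) ℚ./ 1 ≡ i ℚ./ 1 ℚ.+ j ℚ./ 1
/1-homo-+ i j = ℚ.toℚᵘ-injective (begin
  ℚ.toℚᵘ ((i ℤ.+ j) ℚ./ 1)                   ≈⟨ toℚᵘ-/1 (i ℤ.+ j) ⟩
  ℚᵘ.mkℚᵘ (i ℤ.+ j) 0
    ≈⟨ ℚᵘ.*≡* (cong (ℤ._* 1ℤ) (≡.sym (≡.cong₂ ℤ._+_ (ℤ.*-identityʳ i) (ℤ.*-identityʳ j)))) ⟩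
  ℚᵘ.mkℚᵘ i 0 ℚᵘ.+ ℚᵘ.mkℚᵘ j 0               ≈⟨ ℚᵘ.+-cong (toℚᵘ-/1 i) (toℚᵘ-/1 j) ⟨
  ℚ.toℚᵘ (i ℚ./ 1) ℚᵘ.+ ℚ.toℚᵘ (j ℚ./ 1)     ≈⟨ ℚ.toℚᵘ-homo-+ (i ℚ./ 1) (j ℚ./ 1) ⟨
  ℚ.toℚᵘ (i ℚ./ 1 ℚ.+ j ℚ./ 1)               ∎)
  where open ℚᵘ.≃-Reasoning

/1-homo-* : ∀ i j → (i ℤ.* j) ℚ./ 1 ≡ (i ℚ./ 1) ℚ.* (j ℚ./ 1)
/1-homo-* i j = ℚ.toℚᵘ-injective (begin
  ℚ.toℚᵘ ((i ℤ.* j) ℚ./ 1)                   ≈⟨ toℚᵘ-/1 (i ℤ.* j) ⟩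
  ℚᵘ.mkℚᵘ i 0 ℚᵘ.* ℚᵘ.mkℚᵘ j 0               ≈⟨ ℚᵘ.*-cong (toℚᵘ-/1 i) (toℚᵘ-/1 j) ⟨
  ℚ.toℚᵘ (i ℚ./ 1) ℚᵘ.* ℚ.toℚᵘ (j ℚ./ 1)     ≈⟨ ℚ.toℚᵘ-homo-* (i ℚ./ 1) (j ℚ./ 1) ⟨
  ℚ.toℚᵘ ((i ℚ./ 1) ℚ.* (j ℚ./ 1))               ∎)
  where open ℚᵘ.≃-Reasoning

/1-homo-neg : ∀ i → (ℤ.- i) ℚ./ 1 ≡ ℚ.- (i ℚ./ 1)
/1-homo-neg i = ℚ.toℚᵘ-injective (begin
  ℚ.toℚᵘ ((ℤ.- i) ℚ./ 1)        ≈⟨ toℚᵘ-/1 (ℤ.- i) ⟩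
  ℚᵘ.- ℚᵘ.mkℚᵘ i 0              ≈⟨ ℚᵘ.-‿cong (toℚᵘ-/1 i) ⟨
  ℚᵘ.- ℚ.toℚᵘ (i ℚ./ 1)         ≈⟨ ℚ.toℚᵘ-homo‿- (i ℚ./ 1) ⟨
  ℚ.toℚᵘ (ℚ.- (i ℚ./ 1))        ∎)
  where open ℚᵘ.≃-Reasoning

↧*p≡↥ : ∀ p → ((↧ p) ℚ./ 1) ℚ.* p ≡ (↥ p) ℚ./ 1
↧*p≡↥ p = ℚ.toℚᵘ-injective (begin
  ℚ.toℚᵘ (((↧ p) ℚ./ 1) ℚ.* p)                 ≈⟨ ℚ.toℚᵘ-homo-* ((↧ p) ℚ./ 1) p ⟩
  ℚ.toℚᵘ ((↧ p) ℚ./ 1) ℚᵘ.* ℚ.toℚᵘ p         ≈⟨ ℚᵘ.*-congʳ (toℚᵘ-/1 (↧ p)) ⟩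
  ℚᵘ.mkℚᵘ (↧ p) 0 ℚᵘ.* ℚ.toℚᵘ p              ≈⟨ ℚᵘ.*≡* (cross p) ⟩
  ℚᵘ.mkℚᵘ (↥ p) 0                            ≈⟨ toℚᵘ-/1 (↥ p) ⟨
  ℚ.toℚᵘ ((↥ p) ℚ./ 1)                       ∎)
  where
  open ℚᵘ.≃-Reasoning
  cross : ∀ p → ℚᵘ.↥ (ℚᵘ.mkℚᵘ (↧ p) 0 ℚᵘ.* ℚ.toℚᵘ p) ℤ.* 1ℤ
              ≡ (↥ p) ℤ.* ℚᵘ.↧ (ℚᵘ.mkℚᵘ (↧ p) 0 ℚᵘ.* ℚ.toℚᵘ p)
  cross (ℚ.mkℚ n d _) rewrite ℕ.+-identityʳ d =
    ≡.trans (ℤ.*-identityʳ (+ suc d ℤ.* n)) (ℤ.*-comm (+ suc d) n)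

/1-pos : ∀ {i} → 0ℤ ℤ.< i → 0ℚ ℚ.< i ℚ./ 1
/1-pos {i} 0<i = ℚ.toℚᵘ-cancel-< (ℚᵘ.<-respʳ-≃ (ℚᵘ.≃-sym (toℚᵘ-/1 i))
  (ℚᵘ.*<* (subst₂ ℤ._<_ (≡.sym (ℤ.*-zeroˡ 1ℤ)) (≡.sym (ℤ.*-identityʳ i)) 0<i)))

coprime-^ : ∀ {m n} k → Coprime m n → Coprime (m ℕ.^ k) n
coprime-^ zero    _          (d∣1 , _)     = ℕ.∣1⇒≡1 d∣1
coprime-^ {m} {n} (suc k) m⊥n {d} (d∣mᵏ⁺¹ , d∣n) =
  coprime-^ k m⊥n (coprime-divisor d⊥m d∣mᵏ⁺¹ , d∣n)
  where
  d⊥m : Coprime d m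
  d⊥m (e∣d , e∣m) = m⊥n (e∣m , ℕ.∣-trans e∣d d∣n)

n<2^n : ∀ n → n ℕ.< 2 ℕ.^ n
n<2^n zero    = ℕ.s≤s ℕ.z≤n
n<2^n (suc n) = begin-strict
  suc n                ≤⟨ n<2^n n ⟩
  2 ℕ.^ n              <⟨ ℕ.m<m+n (2 ℕ.^ n) (ℕ.<-≤-trans (ℕ.s≤s ℕ.z≤n) (n<2^n n)) ⟩
  2 ℕ.^ n ℕ.+ 2 ℕ.^ n  ≡⟨ cong (2 ℕ.^ n ℕ.+_) (ℕ.+-identityʳ (2 ℕ.^ n)) ⟨
  2 ℕ.^ suc n          ∎
  where open ℕ.≤-Reasoning

-- By coprimality every d^k divides ℓ. For d ≥ 2 the choice k = ℓ contradicts ℓ < 2^ℓ ≤ d^ℓ.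
bounded-denominator : ∀ {n d ℓ} → Coprime n d → 0 ℕ.< d → 0 ℕ.< ℓ →
                      (∀ k → d ℕ.^ k ℕ.∣ ℓ ℕ.* n ℕ.^ k) → d ≡ 1
bounded-denominator {n} {suc zero}    _   _ _   _    = ≡.refl
bounded-denominator {n} {d@(suc (suc d-2))} {ℓ@(suc _)} n⊥d _ 0<ℓ divs =
  contradiction (ℕ.∣⇒≤ dˡ∣ℓ) (ℕ.<⇒≱ (ℕ.<-≤-trans (n<2^n ℓ) (ℕ.^-monoˡ-≤ ℓ (ℕ.s≤s (ℕ.s≤s ℕ.z≤n)))))
  where
  dˡ⊥nˡ : Coprime (d ℕ.^ ℓ) (n ℕ.^ ℓ)
  dˡ⊥nˡ = coprime-^ ℓ (Coprimality.sym (coprime-^ ℓ n⊥d))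
  dˡ∣ℓ : d ℕ.^ ℓ ℕ.∣ ℓ
  dˡ∣ℓ = coprime-divisor dˡ⊥nˡ (subst (d ℕ.^ ℓ ℕ.∣_) (ℕ.*-comm ℓ (n ℕ.^ ℓ)) (divs ℓ))

-- Ordered algebras over ℚ

-- Comparison is classical in character: in place of decidability, only
-- antisymmetry of ≤ is required, so case distinctions on signs are available
-- when the goal is ⊥.
record OrderedℚAlgebra : Set₁ where
  field
    commutativeRing : CommutativeRing 0ℓ 0ℓ
  open CommutativeRing commutativeRing public
  field
    Pos         : Pred Carrier 0ℓ
    Pos-resp-≈  : ∀ {x y} → x ≈ y → Pos x → Pos y
    Pos-+       : ∀ {x y} → Pos x → Pos y → Pos (x + y)
    Pos-*       : ∀ {x y} → Pos x → Pos y → Pos (x * y)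
    ¬Pos-0      : ¬ Pos 0#
    Pos-connex  : ∀ {x} → ¬ Pos x → ¬ Pos (- x) → x ≈ 0#
    ι           : ℚ → Carrier
    ι-+         : ∀ p q → ι (p ℚ.+ q) ≈ ι p + ι q
    ι-*         : ∀ p q → ι (p ℚ.* q) ≈ ι p * ι q
    ι-neg       : ∀ p → ι (ℚ.- p) ≈ - ι p
    ι-0         : ι 0ℚ ≈ 0#
    ι-1         : ι 1ℚ ≈ 1#
    ι-pos       : ∀ {p} → 0ℚ ℚ.< p → Pos (ι p)

module Theory (𝓐 : OrderedℚAlgebra) where
  open OrderedℚAlgebra 𝓐
  open import Algebra.Properties.Semiring.Exp semiring using (_^_) public
  open import Algebra.Properties.Ring ring using (-0#≈0#)

  int : ℤ → Carrier
  int i = ι (i ℚ./ 1)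

  reflexive-ι : ∀ {p q} → p ≡ q → ι p ≈ ι q
  reflexive-ι ≡.refl = refl

  int-+ : ∀ i j → int (i ℤ.+ j) ≈ int i + int j
  int-+ i j = trans (reflexive-ι (/1-homo-+ i j)) (ι-+ (i ℚ./ 1) (j ℚ./ 1))

  int-* : ∀ i j → int (i ℤ.* j) ≈ int i * int j
  int-* i j = trans (reflexive-ι (/1-homo-* i j)) (ι-* (i ℚ./ 1) (j ℚ./ 1))

  int-neg : ∀ i → int (ℤ.- i) ≈ - int i
  int-neg i = trans (reflexive-ι (/1-homo-neg i)) (ι-neg (i ℚ./ 1))

  private
    -- The ring solver computes with integer coefficients, whose equality is decidable, and maps
    -- them into the algebra. Numerals in the certificates below are therefore `con` of an integer.
    int-morphism : ℤ.+-*-rawRing -Raw-AlmostCommutative⟶ fromCommutativeRing commutativeRing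
    int-morphism = record
      { ⟦_⟧    = int
      ; +-homo = int-+
      ; *-homo = int-*
      ; -‿homo = int-neg
      ; 0-homo = ι-0
      ; 1-homo = ι-1
      }

    int-≟ : WeaklyDecidable (λ i j → int i ≈ int j)
    int-≟ i j = Maybe.map (λ i≡j → reflexive (cong int i≡j)) (dec⇒maybe (i ℤ.≟ j))

  module Solver = RingSolver ℤ.+-*-rawRing (fromCommutativeRing commutativeRing) int-morphism int-≟
  open Solver using (Polynomial; solve; _:+_; _:*_; :-_; _:-_; _:^_; _:=_; con)
  open SetoidReasoning setoid

  -- Signs, equality and zero divisors without decidability

  infix 4 _≥0
  -- Nonnegativity as a negation: proving it means deriving `⊥`, where a case distinction on signs
  -- is allowed.
  _≥0 : Pred Carrier 0ℓ
  x ≥0 = ¬ Pos (- x)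

  by-sign : ∀ x → (Pos x → ⊥) → (x ≈ 0# → ⊥) → (Pos (- x) → ⊥) → ⊥
  by-sign x x≯0 x≉0 x≮0 = x≉0 (Pos-connex x≯0 x≮0)

  Pos⇒≉0 : ∀ {x} → Pos x → ¬ x ≈ 0#
  Pos⇒≉0 0<x x≈0 = ¬Pos-0 (Pos-resp-≈ x≈0 0<x)

  Pos-asym : ∀ {x} → Pos x → x ≥0
  Pos-asym {x} 0<x 0<-x = ¬Pos-0 (Pos-resp-≈ (-‿inverseʳ x) (Pos-+ 0<x 0<-x))

  Neg⇒≉0 : ∀ {x} → Pos (- x) → ¬ x ≈ 0#
  Neg⇒≉0 x<0 x≈0 = ¬Pos-0 (Pos-resp-≈ (trans (-‿cong x≈0) -0#≈0#) x<0)

  ≥0-resp-≈ : ∀ {x y} → x ≈ y → x ≥0 → y ≥0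
  ≥0-resp-≈ x≈y x≥0 y<0 = x≥0 (Pos-resp-≈ (-‿cong (sym x≈y)) y<0)

  Pos-+-≥0 : ∀ {x y} → Pos x → y ≥0 → ¬ ¬ Pos (x + y)
  Pos-+-≥0 {x} {y} 0<x y≥0 x+y≯0 = by-sign y
    (λ 0<y → x+y≯0 (Pos-+ 0<x 0<y))
    (λ y≈0 → x+y≯0 (Pos-resp-≈ (trans (sym (+-identityʳ x)) (+-congˡ (sym y≈0))) 0<x))
    y≥0

  -- The format of all estimates below: a positive and a nonnegative expression with sum zero, the
  -- sum being a polynomial identity left to the ring solver.
  absurd : ∀ {x y} → Pos x → y ≥0 → x + y ≈ 0# → ⊥
  absurd 0<x y≥0 x+y≈0 = Pos-+-≥0 0<x y≥0 λ 0<x+y → Pos⇒≉0 0<x+y x+y≈0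

  ≥0-+ : ∀ {x y} → x ≥0 → y ≥0 → (x + y) ≥0
  ≥0-+ {x} {y} x≥0 y≥0 x+y<0 = Pos-+-≥0 x+y<0 y≥0 λ 0<-x →
    x≥0 (Pos-resp-≈ (solve 2 (λ x y → :- (x :+ y) :+ y := :- x) refl x y) 0<-x)

  ≥0-* : ∀ {x y} → x ≥0 → y ≥0 → (x * y) ≥0
  ≥0-* {x} {y} x≥0 y≥0 xy<0 = by-sign x
    (λ 0<x → by-sign y
      (λ 0<y → Pos-asym (Pos-* 0<x 0<y) xy<0)
      (λ y≈0 → Neg⇒≉0 xy<0 (trans (*-congˡ y≈0) (zeroʳ x)))
      y≥0)
    (λ x≈0 → Neg⇒≉0 xy<0 (trans (*-congʳ x≈0) (zeroˡ y)))
    x≥0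

  sq≥0 : ∀ x → (x * x) ≥0
  sq≥0 x xx<0 = by-sign x
    (λ 0<x → Pos-asym (Pos-* 0<x 0<x) xx<0)
    (λ x≈0 → Neg⇒≉0 xx<0 (trans (*-congʳ x≈0) (zeroˡ x)))
    (λ x<0 → Pos-asym (Pos-resp-≈ (solve 1 (λ x → :- x :* :- x := x :* x) refl x) (Pos-* x<0 x<0))
        xx<0)

  Pos-sq : ∀ {x} → ¬ x ≈ 0# → ¬ ¬ Pos (x * x)
  Pos-sq {x} x≉0 ¬pos = by-sign x
    (λ 0<x → ¬pos (Pos-* 0<x 0<x))
    x≉0
    (λ x<0 → ¬pos (Pos-resp-≈ (solve 1 (λ x → :- x :* :- x := x :* x) refl x) (Pos-* x<0 x<0)))

  ≈0-stable : ∀ {x} → ¬ ¬ x ≈ 0# → x ≈ 0#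
  ≈0-stable ¬¬x≈0 = Pos-connex (λ 0<x → ¬¬x≈0 (Pos⇒≉0 0<x)) (λ x<0 → ¬¬x≈0 (Neg⇒≉0 x<0))

  -- By stability y may be assumed nonzero. Then x² and y² are both positive, although their product
  -- is (xy)² = 0.
  integral : ∀ {x y} → x * y ≈ 0# → ¬ x ≈ 0# → y ≈ 0#
  integral {x} {y} xy≈0 x≉0 = ≈0-stable λ y≉0 →
    Pos-sq x≉0 λ 0<xx → Pos-sq y≉0 λ 0<yy → Pos⇒≉0 (Pos-* 0<xx 0<yy) (begin
      x * x * (y * y)    ≈⟨ solve 2 (λ x y → x :* x :* (y :* y) := x :* y :* (x :* y)) refl x y ⟩
      x * y * (x * y)    ≈⟨ *-congʳ xy≈0 ⟩
      0# * (x * y)       ≈⟨ zeroˡ (x * y) ⟩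
      0#                 ∎)

  x-y≈0⇒x≈y : ∀ {x y} → x - y ≈ 0# → x ≈ y
  x-y≈0⇒x≈y {x} {y} x-y≈0 = begin
    x              ≈⟨ solve 2 (λ x y → x := x :- y :+ y) refl x y ⟩
    x - y + y      ≈⟨ +-congʳ x-y≈0 ⟩
    0# + y         ≈⟨ +-identityˡ y ⟩
    y              ∎

  x≈y⇒x-y≈0 : ∀ {x y} → x ≈ y → x - y ≈ 0#
  x≈y⇒x-y≈0 {x} {y} x≈y = trans (+-congʳ x≈y) (-‿inverseʳ y)

  -- Lets the ring solver, which knows only identities, use a relation e = 0: the cofactor `h` of e
  -- in x - y is supplied by hand.
  modulo : ∀ {x y e} h → e ≈ 0# → x ≈ y + h * e → x ≈ y
  modulo {x} {y} {e} h e≈0 x≈y+he = begin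
    x              ≈⟨ x≈y+he ⟩
    y + h * e      ≈⟨ +-congˡ (*-congˡ e≈0) ⟩
    y + h * 0#     ≈⟨ +-congˡ (zeroʳ h) ⟩
    y + 0#         ≈⟨ +-identityʳ y ⟩
    y              ∎

  ≈0-+ : ∀ {x y} → x ≈ 0# → y ≈ 0# → x + y ≈ 0#
  ≈0-+ x≈0 y≈0 = trans (+-cong x≈0 y≈0) (+-identityʳ 0#)

  ≈0-neg : ∀ {x} → x ≈ 0# → - x ≈ 0#
  ≈0-neg x≈0 = trans (-‿cong x≈0) -0#≈0#

  real-product : ∀ r s {i} j → i ≈ 0# → r * s - i * j ≈ r * s
  real-product r s {i} j i≈0 = modulo (- j) i≈0 (solve 4 (λ r s i j → r :* s :- i :* j :=
      r :* s :+ :- j :* i) refl r s i j)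

  imaginary-product : ∀ r s {i j} → i ≈ 0# → j ≈ 0# → r * j + i * s ≈ 0#
  imaginary-product r s i≈0 j≈0 = ≈0-+ (trans (*-congˡ j≈0) (zeroʳ r))
      (trans (*-congʳ i≈0) (zeroˡ s))

  -- The inverse of a real number is real. Expanding j (r s - i j) writes j as a combination of the
  -- two vanishing terms, so nothing is divided by r.
  imaginary-inverse : ∀ r s {i j} → i ≈ 0# → r * s - i * j ≈ 1# → r * j + i * s ≈ 0# → j ≈ 0#
  imaginary-inverse r s {i} {j} i≈0 re≈1 im≈0 = begin
    j                                          ≈⟨ *-identityʳ j ⟨
    j * 1#                                     ≈⟨ *-congˡ re≈1 ⟨
    j * (r * s - i * j)
      ≈⟨ solve 4 (λ r s i j → j :* (r :* s :- i :* j) :=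
          s :* (r :* j :+ i :* s) :+ (:- (s :* s :+ j :* j)) :* i) refl r s i j ⟩
    s * (r * j + i * s) + - (s * s + j * j) * i
      ≈⟨ ≈0-+ (trans (*-congˡ im≈0) (zeroʳ s)) (trans (*-congˡ i≈0) (zeroʳ _)) ⟩
    0#                                         ∎

  int-pos : ∀ {i} → 0ℤ ℤ.< i → Pos (int i)
  int-pos 0<i = ι-pos (/1-pos 0<i)

  int-≥0 : ∀ {i} → 0ℤ ℤ.≤ i → int i ≥0
  int-≥0 {i} 0≤i i<0 with ℤ.<-cmp 0ℤ i
  ... | tri< 0<i _ _ = Pos-asym (int-pos 0<i) i<0
  ... | tri≈ _ ≡.refl _ = Neg⇒≉0 i<0 ι-0
  ... | tri> _ _ i<0′ = ℤ.<⇒≱ i<0′ 0≤i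

  int-reflects-pos : ∀ {i} → Pos (int i) → 0ℤ ℤ.< i
  int-reflects-pos {i} 0<i with ℤ.<-cmp 0ℤ i
  ... | tri< 0<i′ _ _ = 0<i′
  ... | tri≈ _ ≡.refl _ = contradiction ι-0 (Pos⇒≉0 0<i)
  ... | tri> _ _ i<0 = contradiction
    (Pos-resp-≈ (int-neg i) (int-pos (ℤ.neg-mono-< i<0))) (Pos-asym 0<i)

  int≈0⇒≡0 : ∀ {i} → int i ≈ 0# → i ≡ 0ℤ
  int≈0⇒≡0 {i} i≈0 with ℤ.<-cmp 0ℤ i
  ... | tri< 0<i _ _ = contradiction i≈0 (Pos⇒≉0 (int-pos 0<i))
  ... | tri≈ _ 0≡i _ = ≡.sym 0≡i
  ... | tri> _ _ i<0 = contradiction i≈0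
    (Neg⇒≉0 (Pos-resp-≈ (int-neg i) (int-pos (ℤ.neg-mono-< i<0))))

  int-injective : ∀ {i j} → int i ≈ int j → i ≡ j
  int-injective {i} {j} i≈j = ℤ.i-j≡0⇒i≡j i j (int≈0⇒≡0
    (trans (int-+ i (ℤ.- j)) (trans (+-congˡ (int-neg j)) (x≈y⇒x-y≈0 i≈j))))

  -- Subrings; integral and rational elements

  record IsSubring (S : Pred Carrier 0ℓ) : Set where
    field
      resp-≈ : ∀ {x y} → x ≈ y → S x → S y
      int∈   : ∀ i → S (int i)
      +∈     : ∀ {x y} → S x → S y → S (x + y)
      *∈     : ∀ {x y} → S x → S y → S (x * y)
      -∈     : ∀ {x} → S x → S (- x)

    0∈ : S 0#
    0∈ = resp-≈ ι-0 (int∈ 0ℤ)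

    1∈ : S 1#
    1∈ = resp-≈ ι-1 (int∈ 1ℤ)

  Integral Rational : Pred Carrier 0ℓ
  Integral x = ∃[ i ] x ≈ int i
  Rational x = ∃[ q ] x ≈ ι q

  integral-isSubring : IsSubring Integral
  integral-isSubring = record
    { resp-≈ = λ { x≈y (i , x≈i) → i , trans (sym x≈y) x≈i }
    ; int∈   = λ i → i , refl
    ; +∈     = λ { (i , x≈i) (j , y≈j) → i ℤ.+ j , trans (+-cong x≈i y≈j) (sym (int-+ i j)) }
    ; *∈     = λ { (i , x≈i) (j , y≈j) → i ℤ.* j , trans (*-cong x≈i y≈j) (sym (int-* i j)) }
    ; -∈     = λ { (i , x≈i) → ℤ.- i , trans (-‿cong x≈i) (sym (int-neg i)) }
    }

  rational-isSubring : IsSubring Rational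
  rational-isSubring = record
    { resp-≈ = λ { x≈y (p , x≈p) → p , trans (sym x≈y) x≈p }
    ; int∈   = λ i → i ℚ./ 1 , refl
    ; +∈     = λ { (p , x≈p) (q , y≈q) → p ℚ.+ q , trans (+-cong x≈p y≈q) (sym (ι-+ p q)) }
    ; *∈     = λ { (p , x≈p) (q , y≈q) → p ℚ.* q , trans (*-cong x≈p y≈q) (sym (ι-* p q)) }
    ; -∈     = λ { (p , x≈p) → ℚ.- p , trans (-‿cong x≈p) (sym (ι-neg p)) }
    }

  module ℤ-sub = IsSubring integral-isSubring
  module ℚ-sub = IsSubring rational-isSubring

  -- Elimination over ℚ needs to know whether a coefficient vanishes; this is decidable for rational
  -- elements because it can be read off in ℚ.
  rational-≈0? : ∀ {x} → Rational x → Dec (x ≈ 0#)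
  rational-≈0? (q , x≈q) with ℚ.<-cmp 0ℚ q
  ... | tri< 0<q _ _ = no λ x≈0 → Pos⇒≉0 (ι-pos 0<q) (trans (sym x≈q) x≈0)
  ... | tri≈ _ ≡.refl _ = yes (trans x≈q ι-0)
  ... | tri> _ _ q<0 = no λ x≈0 →
    Neg⇒≉0 (Pos-resp-≈ (ι-neg q) (ι-pos (ℚ.neg-antimono-< q<0))) (trans (sym x≈q) x≈0)

  rational-inverse : ∀ {x} → Rational x → ¬ x ≈ 0# → ∃[ y ] (Rational y × x * y ≈ 1#)
  rational-inverse {x} (q , x≈q) x≉0 = ι (ℚ.1/ q) , (ℚ.1/ q , refl) , (begin
      x * ι (ℚ.1/ q)      ≈⟨ *-congʳ x≈q ⟩
      ι q * ι (ℚ.1/ q)    ≈⟨ ι-* q (ℚ.1/ q) ⟨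
      ι (q ℚ.* ℚ.1/ q)    ≈⟨ reflexive-ι (ℚ.*-inverseʳ q) ⟩
      ι 1ℚ                ≈⟨ ι-1 ⟩
      1#                  ∎)
    where
    instance
      q≢0 : ℚ.NonZero q
      q≢0 = ℚ.≢-nonZero {q} λ { ≡.refl → x≉0 (trans x≈q ι-0) }

  clear-denominator : ∀ {x} → Rational x → ∃[ d ] (d ≢ 0ℤ × Integral (int d * x))
  clear-denominator {x} (q , x≈q) = ↧ q , (λ ()) , ↥ q , (begin
    int (↧ q) * x            ≈⟨ *-congˡ x≈q ⟩
    int (↧ q) * ι q          ≈⟨ ι-* ((↧ q) ℚ./ 1) q ⟨
    ι (((↧ q) ℚ./ 1) ℚ.* q)  ≈⟨ reflexive-ι (↧*p≡↥ q) ⟩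
    int (↥ q)                ∎)

  int-^ : ∀ i k → int (i ℤ.^ k) ≈ int i ^ k
  int-^ i zero    = ι-1
  int-^ i (suc k) = trans (int-* i (i ℤ.^ k)) (*-congˡ (int-^ i k))

  -- For x = n/d in lowest terms the hypothesis says that d^k divides L n^k for every k, so
  -- `bounded-denominator` gives d = 1.
  integrally-closed : ∀ {x L} → Rational x → L ≢ 0ℤ → (∀ k → Integral (int L * x ^ k)) → Integral x
  integrally-closed {x} {L} (q@(ℚ.mkℚ n d-1 n⊥d) , x≈q) L≢0 powers = n , (begin
    x                   ≈⟨ *-identityˡ x ⟨
    1# * x              ≈⟨ *-congʳ (sym ι-1) ⟩
    int 1ℤ * x          ≡⟨ cong (λ d → int (+ d) * x) d≡1 ⟨
    int (↧ q) * x       ≈⟨ dx≈n ⟩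
    int n               ∎)
    where

    d : ℕ
    d = suc d-1

    dx≈n : int (+ d) * x ≈ int n
    dx≈n = proj₂ (proj₂ (proj₂ (clear-denominator (q , x≈q))))

    dᵏxᵏ≈nᵏ : ∀ k → int (+ d) ^ k * x ^ k ≈ int n ^ k
    dᵏxᵏ≈nᵏ zero    = *-identityˡ 1#
    dᵏxᵏ≈nᵏ (suc k) = trans
      (solve 4 (λ d x D X → d :* D :* (x :* X) := d :* x :* (D :* X)) refl
        (int (+ d)) x (int (+ d) ^ k) (x ^ k))
      (*-cong dx≈n (dᵏxᵏ≈nᵏ k))

    Lnᵏ≡zdᵏ : ∀ k → L ℤ.* n ℤ.^ k ≡ proj₁ (powers k) ℤ.* (+ d) ℤ.^ k
    Lnᵏ≡zdᵏ k = int-injective (begin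
      int (L ℤ.* n ℤ.^ k)                      ≈⟨ int-* L (n ℤ.^ k) ⟩
      int L * int (n ℤ.^ k)                    ≈⟨ *-congˡ (trans (int-^ n k) (sym (dᵏxᵏ≈nᵏ k))) ⟩
      int L * (int (+ d) ^ k * x ^ k)
        ≈⟨ solve 3 (λ L D X → L :* (D :* X) := L :* X :* D) refl (int L) (int (+ d) ^ k) (x ^ k) ⟩
      int L * x ^ k * int (+ d) ^ k            ≈⟨ *-cong (proj₂ (powers k)) (sym (int-^ (+ d) k)) ⟩
      int z * int ((+ d) ℤ.^ k)                ≈⟨ int-* z ((+ d) ℤ.^ k) ⟨
      int (z ℤ.* (+ d) ℤ.^ k)                  ∎)
      where
      z : ℤ
      z = proj₁ (powers k)

    ∣i^k∣ : ∀ i k → ℤ.∣ i ℤ.^ k ∣ ≡ ℤ.∣ i ∣ ℕ.^ k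
    ∣i^k∣ i zero    = ≡.refl
    ∣i^k∣ i (suc k) = ≡.trans (ℤ.abs-* i (i ℤ.^ k)) (cong (ℤ.∣ i ∣ ℕ.*_) (∣i^k∣ i k))

    dᵏ∣Lnᵏ : ∀ k → d ℕ.^ k ℕ.∣ ℤ.∣ L ∣ ℕ.* ℤ.∣ n ∣ ℕ.^ k
    dᵏ∣Lnᵏ k = ℕ.divides ℤ.∣ proj₁ (powers k) ∣ (≡.trans
      (≡.sym (≡.trans (ℤ.abs-* L (n ℤ.^ k)) (cong (ℤ.∣ L ∣ ℕ.*_) (∣i^k∣ n k))))
      (≡.trans (cong ℤ.∣_∣ (Lnᵏ≡zdᵏ k))
        (≡.trans (ℤ.abs-* (proj₁ (powers k)) ((+ d) ℤ.^ k))
          (cong (ℤ.∣ proj₁ (powers k) ∣ ℕ.*_) (∣i^k∣ (+ d) k)))))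

    d≡1 : d ≡ 1
    d≡1 = bounded-denominator (Coprimality.recompute n⊥d) (ℕ.s≤s ℕ.z≤n)
      (ℕ.n≢0⇒n>0 (λ ∣L∣≡0 → L≢0 (ℤ.∣i∣≡0⇒i≡0 ∣L∣≡0))) dᵏ∣Lnᵏ

  integral⊆rational : ∀ {x} → Integral x → Rational x
  integral⊆rational (i , x≈i) = i ℚ./ 1 , x≈i

  -- Cubic polynomials and their splitting over ℚ(α)

  cubic : (b c d x : Carrier) → Carrier
  cubic b c d x = x * x * x + b * (x * x) + c * x + d

  -- This is 4 Q - P², the negated discriminant of the cofactor X² + P X + Q of X - x, where P = b +
  -- x and Q = c + b x + x².
  disc : (b c x : Carrier) → Carrier
  disc b c x = int (+ 4) * c - b * b + int (+ 2) * b * x + int (+ 3) * (x * x)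

  cubicᵖ : ∀ {n} (b c d x : Polynomial n) → Polynomial n
  cubicᵖ b c d x = x :* x :* x :+ b :* (x :* x) :+ c :* x :+ d

  discᵖ : ∀ {n} (b c x : Polynomial n) → Polynomial n
  discᵖ b c x = con (+ 4) :* c :- b :* b :+ con (+ 2) :* b :* x :+ con (+ 3) :* (x :* x)

  -- The cofactor x² + P x + Q of x - y has no zero, as 4 (x² + P x + Q) = (2 x + P)² + D.
  cubic-root-unique : ∀ {b c d x y} → Pos (disc b c y) → cubic b c d y ≈ 0# → cubic b c d x ≈ 0# →
      x ≈ y
  cubic-root-unique {b} {c} {d} {x} {y} 0<D fy≈0 fx≈0 = x-y≈0⇒x≈y (≈0-stable λ x-y≉0 →
    let q≈0 = integral (trans (modulo (int -1ℤ) fy≈0 (factor b c d x y)) fx≈0) x-y≉0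
    in absurd 0<D (sq≥0 (int (+ 2) * x + (b + y)))
         (trans (complete-square b c x y) (trans (*-congˡ q≈0) (zeroʳ _))))
    where
    factor : ∀ b c d x y → (x - y) * (x * x + (b + y) * x + (c + b * y + y * y)) ≈
                           cubic b c d x + int -1ℤ * cubic b c d y
    factor = solve 5 (λ b c d x y →
      (x :- y) :* (x :* x :+ (b :+ y) :* x :+ (c :+ b :* y :+ y :* y)) :=
      cubicᵖ b c d x :+ con -1ℤ :* cubicᵖ b c d y) refl
    complete-square : ∀ b c x y →
      disc b c y + (int (+ 2) * x + (b + y)) * (int (+ 2) * x + (b + y)) ≈
                      int (+ 4) * (x * x + (b + y) * x + (c + b * y + y * y))
    complete-square = solve 4 (λ b c x y →
      discᵖ b c y :+ (con (+ 2) :* x :+ (b :+ y)) :* (con (+ 2) :* x :+ (b :+ y)) :=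
      con (+ 4) :* (x :* x :+ (b :+ y) :* x :+ (c :+ b :* y :+ y :* y))) refl

  record Triple : Set where
    constructor ⟨_,_,_⟩
    field
      u v w : Carrier
  open Triple public

  Entries : Pred Carrier 0ℓ → Pred Triple 0ℓ
  Entries S t = S (u t) × S (v t) × S (w t)

  -- The field ℚ(α) in coordinates with respect to 1, α, α².  Its complex
  -- embedding sends α to the class of X in 𝓐[X]/(X² + P X + Q), where
  -- f = (X - α)(X² + P X + Q) has complex conjugate roots other than α.
  module Extension (b c d α : Carrier) (fα≈0 : cubic b c d α ≈ 0#) where
    P Q D : Carrier
    P = b + α
    Q = c + b * α + α * α
    D = disc b c α

    -- Here `re t + im t X` is u + v X + w X² reduced modulo X² + P X + Q. Thus `im` is a
    -- coordinate; the imaginary part proper is `im t` times √D/2. `tr` and `nm` are the trace and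
    -- the norm of this class, that is, twice its real part and its squared absolute value.
    ev re im tr nm : Triple → Carrier
    ev t = u t + v t * α + w t * (α * α)
    re t = u t - w t * Q
    im t = v t - w t * P
    tr t = int (+ 2) * re t - P * im t
    nm t = re t * re t - P * re t * im t + Q * (im t * im t)

    infixl 6 _⊕_
    infixl 7 _⊙_ _⊛_

    _⊕_ : Triple → Triple → Triple
    s ⊕ t = ⟨ u s + u t , v s + v t , w s + w t ⟩

    _⊙_ : Carrier → Triple → Triple
    k ⊙ t = ⟨ k * u t , k * v t , k * w t ⟩

    α⊛ : Triple → Triple
    α⊛ t = ⟨ - (d * w t) , u t - c * w t , v t - b * w t ⟩

    _⊛_ : Triple → Triple → Triple
    s ⊛ t = u s ⊙ t ⊕ v s ⊙ α⊛ t ⊕ w s ⊙ α⊛ (α⊛ t)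

    det : Triple → Triple → Triple → Carrier
    det r s t = u r * (v s * w t - w s * v t) - v r * (u s * w t - w s * u t)
              + w r * (u s * v t - v s * u t)

    -- The determinant of multiplication by t in the basis 1, α, α². Being a polynomial in b, c, d
    -- and the coordinates, it is rational or integral whenever these are.
    norm : Triple → Carrier
    norm t = det t (α⊛ t) (α⊛ (α⊛ t))

    private
      f : Carrier
      f = cubic b c d α

    ev-⊕ : ∀ s t → ev (s ⊕ t) ≈ ev s + ev t
    ev-⊕ s t = solve 7 (λ α u v w u′ v′ w′ →
      (u :+ u′) :+ (v :+ v′) :* α :+ (w :+ w′) :* (α :* α) :=
      (u :+ v :* α :+ w :* (α :* α)) :+ (u′ :+ v′ :* α :+ w′ :* (α :* α)))
      refl α (u s) (v s) (w s) (u t) (v t) (w t)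

    ev-⊙ : ∀ k t → ev (k ⊙ t) ≈ k * ev t
    ev-⊙ k t = solve 5 (λ α k u v w →
      k :* u :+ (k :* v) :* α :+ (k :* w) :* (α :* α) := k :* (u :+ v :* α :+ w :* (α :* α)))
      refl α k (u t) (v t) (w t)

    ev-α⊛ : ∀ t → ev (α⊛ t) ≈ α * ev t
    ev-α⊛ t = modulo (- w t) fα≈0 (solve 7 (λ b c d α u v w →
      :- (d :* w) :+ (u :- c :* w) :* α :+ (v :- b :* w) :* (α :* α) :=
      α :* (u :+ v :* α :+ w :* (α :* α)) :+ :- w :* cubicᵖ b c d α)
      refl b c d α (u t) (v t) (w t))

    ev-⊛ : ∀ s t → ev (s ⊛ t) ≈ ev s * ev t
    ev-⊛ s t = begin
      ev (s ⊛ t)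
        ≈⟨ trans (ev-⊕ (u s ⊙ t ⊕ v s ⊙ α⊛ t) (w s ⊙ α⊛ (α⊛ t)))
            (+-congʳ (ev-⊕ (u s ⊙ t) (v s ⊙ α⊛ t))) ⟩
      ev (u s ⊙ t) + ev (v s ⊙ α⊛ t) + ev (w s ⊙ α⊛ (α⊛ t))
        ≈⟨ +-cong (+-cong (ev-⊙ (u s) t) (trans (ev-⊙ (v s) (α⊛ t)) (*-congˡ (ev-α⊛ t))))
                  (trans (ev-⊙ (w s) (α⊛ (α⊛ t)))
                      (*-congˡ (trans (ev-α⊛ (α⊛ t)) (*-congˡ (ev-α⊛ t))))) ⟩
      u s * ev t + v s * (α * ev t) + w s * (α * (α * ev t))
        ≈⟨ solve 5 (λ α u v w e → u :* e :+ v :* (α :* e) :+ w :* (α :* (α :* e)) :=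
                                  (u :+ v :* α :+ w :* (α :* α)) :* e)
                                      refl α (u s) (v s) (w s) (ev t) ⟩
      ev s * ev t
        ∎

    re-⊕ : ∀ s t → re (s ⊕ t) ≈ re s + re t
    re-⊕ s t = solve 5 (λ Q u w u′ w′ → (u :+ u′) :- (w :+ w′) :* Q :=
        (u :- w :* Q) :+ (u′ :- w′ :* Q))
      refl Q (u s) (w s) (u t) (w t)

    im-⊕ : ∀ s t → im (s ⊕ t) ≈ im s + im t
    im-⊕ s t = solve 5 (λ P u w u′ w′ → (u :+ u′) :- (w :+ w′) :* P :=
        (u :- w :* P) :+ (u′ :- w′ :* P))
      refl P (v s) (w s) (v t) (w t)

    re-⊙ : ∀ k t → re (k ⊙ t) ≈ k * re t
    re-⊙ k t = solve 4 (λ Q k u w → k :* u :- (k :* w) :* Q := k :* (u :- w :* Q))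
        refl Q k (u t) (w t)

    im-⊙ : ∀ k t → im (k ⊙ t) ≈ k * im t
    im-⊙ k t = solve 4 (λ P k u w → k :* u :- (k :* w) :* P := k :* (u :- w :* P))
        refl P k (v t) (w t)

    re-α⊛ : ∀ t → re (α⊛ t) ≈ - (Q * im t)
    re-α⊛ t = modulo (- w t) fα≈0 (solve 6 (λ b c d α v w →
      :- (d :* w) :- (v :- b :* w) :* (c :+ b :* α :+ α :* α) :=
      :- ((c :+ b :* α :+ α :* α) :* (v :- w :* (b :+ α))) :+ :- w :* cubicᵖ b c d α)
      refl b c d α (v t) (w t))

    im-α⊛ : ∀ t → im (α⊛ t) ≈ re t - P * im t
    im-α⊛ t = solve 6 (λ b c α u v w →
      (u :- c :* w) :- (v :- b :* w) :* (b :+ α) :=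
      (u :- w :* (c :+ b :* α :+ α :* α)) :- (b :+ α) :* (v :- w :* (b :+ α)))
      refl b c α (u t) (v t) (w t)

    re-⊛ : ∀ s t → re (s ⊛ t) ≈ re s * re t - Q * (im s * im t)
    re-⊛ s t = begin
      re (s ⊛ t)
        ≈⟨ trans (re-⊕ (u s ⊙ t ⊕ v s ⊙ α⊛ t) (w s ⊙ α⊛ (α⊛ t)))
            (+-congʳ (re-⊕ (u s ⊙ t) (v s ⊙ α⊛ t))) ⟩
      re (u s ⊙ t) + re (v s ⊙ α⊛ t) + re (w s ⊙ α⊛ (α⊛ t))
        ≈⟨ +-cong (+-cong (re-⊙ (u s) t) (trans (re-⊙ (v s) (α⊛ t)) (*-congˡ (re-α⊛ t))))
             (trans (re-⊙ (w s) (α⊛ (α⊛ t)))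
               (*-congˡ (trans (re-α⊛ (α⊛ t)) (-‿cong (*-congˡ (im-α⊛ t)))))) ⟩
      u s * re t + v s * - (Q * im t) + w s * - (Q * (re t - P * im t))
        ≈⟨ solve 7 (λ P Q u v w r i →
             u :* r :+ v :* :- (Q :* i) :+ w :* :- (Q :* (r :- P :* i)) :=
             (u :- w :* Q) :* r :- Q :* ((v :- w :* P) :* i))
                 refl P Q (u s) (v s) (w s) (re t) (im t) ⟩
      re s * re t - Q * (im s * im t)
        ∎

    im-⊛ : ∀ s t → im (s ⊛ t) ≈ re s * im t + im s * re t - P * (im s * im t)
    im-⊛ s t = begin
      im (s ⊛ t)
        ≈⟨ trans (im-⊕ (u s ⊙ t ⊕ v s ⊙ α⊛ t) (w s ⊙ α⊛ (α⊛ t)))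
            (+-congʳ (im-⊕ (u s ⊙ t) (v s ⊙ α⊛ t))) ⟩
      im (u s ⊙ t) + im (v s ⊙ α⊛ t) + im (w s ⊙ α⊛ (α⊛ t))
        ≈⟨ +-cong (+-cong (im-⊙ (u s) t) (trans (im-⊙ (v s) (α⊛ t)) (*-congˡ (im-α⊛ t))))
             (trans (im-⊙ (w s) (α⊛ (α⊛ t))) (*-congˡ (trans (im-α⊛ (α⊛ t))
               (+-cong (re-α⊛ t) (-‿cong (*-congˡ (im-α⊛ t))))))) ⟩
      u s * im t + v s * (re t - P * im t) + w s * (- (Q * im t) - P * (re t - P * im t))
        ≈⟨ solve 7 (λ P Q u v w r i →
             u :* i :+ v :* (r :- P :* i) :+ w :* (:- (Q :* i) :- P :* (r :- P :* i)) :=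
             (u :- w :* Q) :* i :+ (v :- w :* P) :* r :- P :* ((v :- w :* P) :* i))
             refl P Q (u s) (v s) (w s) (re t) (im t) ⟩
      re s * im t + im s * re t - P * (im s * im t)
        ∎

    nm-cong : ∀ {s t} → re s ≈ re t → im s ≈ im t → nm s ≈ nm t
    nm-cong r i = +-cong (+-cong (*-cong r r) (-‿cong (*-cong (*-congˡ r) i)))
        (*-congˡ (*-cong i i))

    nm-⊛ : ∀ s t → nm (s ⊛ t) ≈ nm s * nm t
    nm-⊛ s t = trans
      (+-cong (+-cong (*-cong (re-⊛ s t) (re-⊛ s t))
                      (-‿cong (*-cong (*-congˡ (re-⊛ s t)) (im-⊛ s t))))
              (*-congˡ (*-cong (im-⊛ s t) (im-⊛ s t))))
      (solve 6 (λ P Q r i r′ i′ →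
        let R = r :* r′ :- Q :* (i :* i′)
            I = r :* i′ :+ i :* r′ :- P :* (i :* i′)
        in R :* R :- P :* R :* I :+ Q :* (I :* I) :=
           (r :* r :- P :* r :* i :+ Q :* (i :* i)) :* (r′ :* r′ :- P :* r′ :* i′
               :+ Q :* (i′ :* i′)))
        refl P Q (re s) (im s) (re t) (im t))

    -- The norm is the product over the real embedding and the two complex ones. As polynomials in α
    -- the two sides agree only up to a multiple of f; the long factor is the quotient.
    norm-factors : ∀ t → norm t ≈ ev t * nm t
    norm-factors t = sym (modulo
      (w t * w t * w t * f - int (+ 2) * d * w t * w t * w t + int (+ 2) * b * u t * w t * w t
          - b * v t * v t * w t
        + c * v t * w t * w t - int (+ 3) * u t * v t * w t + v t * v t * v t)
      fα≈0
      (solve 7 (λ b c d α u v w →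
        let u₁ = :- (d :* w)
            v₁ = u :- c :* w
            w₁ = v :- b :* w
            u₂ = :- (d :* w₁)
            v₂ = u₁ :- c :* w₁
            w₂ = v₁ :- b :* w₁
            P = b :+ α
            Q = c :+ b :* α :+ α :* α
            R = u :- w :* Q
            I = v :- w :* P
        in (u :+ v :* α :+ w :* (α :* α)) :* (R :* R :- P :* R :* I :+ Q :* (I :* I)) :=
           (u :* (v₁ :* w₂ :- w₁ :* v₂) :- v :* (u₁ :* w₂ :- w₁ :* u₂)
               :+ w :* (u₁ :* v₂ :- v₁ :* u₂))
           :+ (w :* w :* w :* cubicᵖ b c d α :- con (+ 2) :* d :* w :* w :* w
               :+ con (+ 2) :* b :* u :* w :* w :- b :* v :* v :* w
               :+ c :* v :* w :* w :- con (+ 3) :* u :* v :* w :+ v :* v :* v) :* cubicᵖ b c d α)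
        refl b c d α (u t) (v t) (w t)))

    norm-⊛ : ∀ s t → norm (s ⊛ t) ≈ norm s * norm t
    norm-⊛ s t = begin
      norm (s ⊛ t)                    ≈⟨ norm-factors (s ⊛ t) ⟩
      ev (s ⊛ t) * nm (s ⊛ t)         ≈⟨ *-cong (ev-⊛ s t) (nm-⊛ s t) ⟩
      ev s * ev t * (nm s * nm t)
        ≈⟨ solve 4 (λ e e′ n n′ → e :* e′ :* (n :* n′) := e :* n :* (e′ :* n′))
            refl (ev s) (ev t) (nm s) (nm t) ⟩
      ev s * nm s * (ev t * nm t)     ≈⟨ *-cong (norm-factors s) (norm-factors t) ⟨
      norm s * norm t                 ∎

    -- Completing the square. As D is positive, this makes `nm` positive definite, which is all that
    -- is used of complex absolute values.
    4nm≈tr²+Dim² : ∀ t → int (+ 4) * nm t ≈ tr t * tr t + D * (im t * im t)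
    4nm≈tr²+Dim² t = solve 5 (λ b c α r i →
      con (+ 4) :* (r :* r :- (b :+ α) :* r :* i :+ (c :+ b :* α :+ α :* α) :* (i :* i)) :=
      (con (+ 2) :* r :- (b :+ α) :* i) :* (con (+ 2) :* r :- (b :+ α) :* i) :+ discᵖ b c
          α :* (i :* i))
      refl b c α (re t) (im t)

  -- Instantiated with rational coordinates for ℚ(α), and with integral ones for ℤ[α].
  module Entrywise {S : Pred Carrier 0ℓ} (S-isSubring : IsSubring S) {b c d} (b∈ : S b) (c∈ : S c)
      (d∈ : S d)
                   {α} (fα≈0 : cubic b c d α ≈ 0#) where
    open IsSubring S-isSubring
    open Extension b c d α fα≈0

    ⊕-entries : ∀ {s t} → Entries S s → Entries S t → Entries S (s ⊕ t)
    ⊕-entries (us , vs , ws) (ut , vt , wt) = +∈ us ut , +∈ vs vt , +∈ ws wt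

    ⊙-entries : ∀ {k t} → S k → Entries S t → Entries S (k ⊙ t)
    ⊙-entries k (ut , vt , wt) = *∈ k ut , *∈ k vt , *∈ k wt

    α⊛-entries : ∀ {t} → Entries S t → Entries S (α⊛ t)
    α⊛-entries (ut , vt , wt) =
      -∈ (*∈ d∈ wt) , +∈ ut (-∈ (*∈ c∈ wt)) , +∈ vt (-∈ (*∈ b∈ wt))

    ⊛-entries : ∀ {s t} → Entries S s → Entries S t → Entries S (s ⊛ t)
    ⊛-entries (us , vs , ws) t∈ =
      ⊕-entries (⊕-entries (⊙-entries us t∈) (⊙-entries vs (α⊛-entries t∈)))
                (⊙-entries ws (α⊛-entries (α⊛-entries t∈)))

    det-entries : ∀ {r s t} → Entries S r → Entries S s → Entries S t → S (det r s t)
    det-entries (u₁ , v₁ , w₁) (u₂ , v₂ , w₂) (u₃ , v₃ , w₃) =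
      +∈ (+∈ (*∈ u₁ (minor v₂ w₃ w₂ v₃)) (-∈ (*∈ v₁ (minor u₂ w₃ w₂ u₃))))
          (*∈ w₁ (minor u₂ v₃ v₂ u₃))
      where
      minor : ∀ {x y z k} → S x → S y → S z → S k → S (x * y - z * k)
      minor x y z k = +∈ (*∈ x y) (-∈ (*∈ z k))

    norm-entries : ∀ {t} → Entries S t → S (norm t)
    norm-entries t∈ = det-entries t∈ (α⊛-entries t∈) (α⊛-entries (α⊛-entries t∈))

  record IrrationalRoot (b c d α : Carrier) : Set where
    field
      b∈ℤ : Integral b
      c∈ℤ : Integral c
      d∈ℤ : Integral d
      fα≈0 : cubic b c d α ≈ 0#
      0<D : Pos (disc b c α)
      α∉ℚ : ¬ Rational α

  -- The field ℚ(α) for an irrational root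

  module CubicField {b c d α} (α-root : IrrationalRoot b c d α) where
    open IrrationalRoot α-root
    open Extension b c d α fα≈0 public
    private
      b∈ℚ = integral⊆rational b∈ℤ
      c∈ℚ = integral⊆rational c∈ℤ
      d∈ℚ = integral⊆rational d∈ℤ

    module ℤ³ = Entrywise integral-isSubring b∈ℤ c∈ℤ d∈ℤ fα≈0
    module ℚ³ = Entrywise rational-isSubring b∈ℚ c∈ℚ d∈ℚ fα≈0

    1-α-independent : ∀ {p q} → Rational p → Rational q → p * α + q ≈ 0# → p ≈ 0# × q ≈ 0#
    1-α-independent {p} {q} p∈ q∈ pα+q≈0 with rational-≈0? p∈
    ... | yes p≈0 = p≈0 , (begin
          q              ≈⟨ solve 2 (λ q α → q := con 0ℤ :* α :+ q) refl q α ⟩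
          int 0ℤ * α + q ≈⟨ +-congʳ (*-congʳ (trans ι-0 (sym p≈0))) ⟩
          p * α + q      ≈⟨ pα+q≈0 ⟩
          0#             ∎)
    ... | no p≉0 = let p⁻¹ , p⁻¹∈ , pp⁻¹≈1 = rational-inverse p∈ p≉0 in
      contradiction (ℚ-sub.resp-≈ (sym (begin
        α                                ≈⟨ *-identityʳ α ⟨
        α * 1#                           ≈⟨ *-congˡ pp⁻¹≈1 ⟨
        α * (p * p⁻¹)
          ≈⟨ modulo p⁻¹ pα+q≈0 (solve 4 (λ α p q k → α :* (p :* k) :=
              :- (q :* k) :+ k :* (p :* α :+ q)) refl α p q p⁻¹) ⟩
        - (q * p⁻¹)                      ∎)) (ℚ-sub.-∈ (ℚ-sub.*∈ q∈ p⁻¹∈))) α∉ℚ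

    -- A monic quadratic relation α² + p α + q = 0 would make p - b a second root of f.
    α-not-quadratic : ∀ {p q} → Rational p → Rational q → ¬ α * α + p * α + q ≈ 0#
    α-not-quadratic {p} {q} p∈ q∈ α²+pα+q≈0 = α∉ℚ (ℚ-sub.resp-≈ r≈α r∈)
      where
      r : Carrier
      r = p - b

      r∈ : Rational r
      r∈ = ℚ-sub.+∈ p∈ (ℚ-sub.-∈ b∈ℚ)

      remainder≈0 : c - q - (b - p) * p ≈ 0# × d - (b - p) * q ≈ 0#
      remainder≈0 = 1-α-independent
        (ℚ-sub.+∈ (ℚ-sub.+∈ c∈ℚ (ℚ-sub.-∈ q∈))
            (ℚ-sub.-∈ (ℚ-sub.*∈ (ℚ-sub.+∈ b∈ℚ (ℚ-sub.-∈ p∈)) p∈)))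
        (ℚ-sub.+∈ d∈ℚ (ℚ-sub.-∈ (ℚ-sub.*∈ (ℚ-sub.+∈ b∈ℚ (ℚ-sub.-∈ p∈)) q∈)))
        (trans (modulo (- (α + (b - p))) α²+pα+q≈0
          (solve 6 (λ b c d α p q →
            (c :- q :- (b :- p) :* p) :* α :+ (d :- (b :- p) :* q) :=
            cubicᵖ b c d α :+ :- (α :+ (b :- p)) :* (α :* α :+ p :* α :+ q)) refl b c d α p q))
                fα≈0)

      r≈α : r ≈ α
      r≈α = cubic-root-unique 0<D fα≈0
        (trans (modulo r (proj₁ remainder≈0)
          (solve 5 (λ b c d p q →
            cubicᵖ b c d (p :- b) :=
            d :- (b :- p) :* q :+ (p :- b) :* (c :- q :- (b :- p) :* p)) refl b c d p q))
          (proj₂ remainder≈0))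

    -- Independence of 1, α, α² over ℚ. If w vanishes, the relation is linear in α; otherwise
    -- division by w yields a monic quadratic relation.
    ev-injective₀ : ∀ {t} → Entries Rational t → ev t ≈ 0# → u t ≈ 0# × v t ≈ 0# × w t ≈ 0#
    ev-injective₀ {⟨ u , v , w ⟩} (u∈ , v∈ , w∈) t≈0 with rational-≈0? w∈
    ... | yes w≈0 =
      let v≈0 , u≈0 = 1-α-independent v∈ u∈ (trans (modulo (- (α * α)) w≈0
            (solve 4 (λ α u v w → v :* α :+ u := u :+ v :* α :+ w :* (α :* α) :+ :- (α :* α) :* w)
                refl α u v w)) t≈0)
      in u≈0 , v≈0 , w≈0
    ... | no w≉0 =
      let w⁻¹ , w⁻¹∈ , ww⁻¹≈1 = rational-inverse w∈ w≉0
      in contradiction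
        (begin
          α * α + v * w⁻¹ * α + u * w⁻¹
            ≈⟨ +-congʳ (+-congʳ (trans (sym (*-identityˡ (α * α))) (*-congʳ (sym ww⁻¹≈1)))) ⟩
          w * w⁻¹ * (α * α) + v * w⁻¹ * α + u * w⁻¹
            ≈⟨ solve 5 (λ α u v w k → w :* k :* (α :* α) :+ v :* k :* α :+ u :* k :=
                (u :+ v :* α :+ w :* (α :* α)) :* k) refl α u v w w⁻¹ ⟩
          (u + v * α + w * (α * α)) * w⁻¹
            ≈⟨ *-congʳ t≈0 ⟩
          0# * w⁻¹
            ≈⟨ zeroˡ w⁻¹ ⟩
          0#
            ∎)
        (α-not-quadratic (ℚ-sub.*∈ v∈ w⁻¹∈) (ℚ-sub.*∈ u∈ w⁻¹∈))

    ℚ[α] : Pred Carrier 0ℓ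
    ℚ[α] x = ∃[ t ] (Entries Rational t × ev t ≈ x)

    rational⊆ℚ[α] : ∀ {x} → Rational x → ℚ[α] x
    rational⊆ℚ[α] {x} x∈ = ⟨ x , 0# , 0# ⟩ , (x∈ , ℚ-sub.0∈ , ℚ-sub.0∈) , (begin
      x + 0# * α + 0# * (α * α)   ≈⟨ +-cong (+-congˡ (zeroˡ α)) (zeroˡ (α * α)) ⟩
      x + 0# + 0#                 ≈⟨ trans (+-identityʳ (x + 0#)) (+-identityʳ x) ⟩
      x                           ∎)

    ℚ[α]-isSubring : IsSubring ℚ[α]
    ℚ[α]-isSubring = record
      { resp-≈ = λ { x≈y (t , t∈ , t≈x) → t , t∈ , trans t≈x x≈y }
      ; int∈   = λ i → rational⊆ℚ[α] (ℚ-sub.int∈ i)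
      ; +∈     = λ { (s , s∈ , s≈x) (t , t∈ , t≈y) →
                   s ⊕ t , ℚ³.⊕-entries s∈ t∈ , trans (ev-⊕ s t) (+-cong s≈x t≈y) }
      ; *∈     = λ { (s , s∈ , s≈x) (t , t∈ , t≈y) →
                   s ⊛ t , ℚ³.⊛-entries s∈ t∈ , trans (ev-⊛ s t) (*-cong s≈x t≈y) }
      ; -∈     = λ { {x} (t , t∈ , t≈x) →
                   int -1ℤ ⊙ t , ℚ³.⊙-entries (ℚ-sub.int∈ -1ℤ) t∈
                   , trans (ev-⊙ (int -1ℤ) t) (trans (*-congˡ t≈x) (solve 1 (λ x → con -1ℤ :* x :=
                       :- x) refl x)) }
      }

    α∈ℚ[α] : ℚ[α] α
    α∈ℚ[α] = ⟨ 0# , 1# , 0# ⟩ , (ℚ-sub.0∈ , ℚ-sub.1∈ , ℚ-sub.0∈) , (begin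
      0# + 1# * α + 0# * (α * α)   ≈⟨ +-cong (+-congˡ (*-identityˡ α)) (zeroˡ (α * α)) ⟩
      0# + α + 0#                  ≈⟨ trans (+-identityʳ (0# + α)) (+-identityˡ α) ⟩
      α                            ∎)

    1≉0 : ¬ 1# ≈ 0#
    1≉0 1≈0 = contradiction (int≈0⇒≡0 {1ℤ} (trans ι-1 1≈0)) λ ()

    -- As P contains α, `im t` is itself the element (v - b w) - w α of ℚ(α), to which independence
    -- applies.
    rational⇒im≈0⇒v≈0×w≈0 : ∀ {t} → Entries Rational t → im t ≈ 0# → v t ≈ 0# × w t ≈ 0#
    rational⇒im≈0⇒v≈0×w≈0 {⟨ u , v , w ⟩} (u∈ , v∈ , w∈) im≈0 =
      let v-bw≈0 , -w≈0 , _ = ev-injective₀ {⟨ v - b * w , - w , 0# ⟩}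
            (ℚ-sub.+∈ v∈ (ℚ-sub.-∈ (ℚ-sub.*∈ b∈ℚ w∈)) , ℚ-sub.-∈ w∈ , ℚ-sub.0∈)
            (trans (+-congˡ (zeroˡ (α * α))) (trans (+-identityʳ _)
              (trans (solve 4 (λ b α v w → v :- b :* w :+ :- w :* α := v :- w :* (b :+ α))
                  refl b α v w) im≈0)))
          w≈0 = trans (solve 1 (λ w → w := con -1ℤ :* :- w) refl w) (trans (*-congˡ -w≈0) (zeroʳ _))
      in trans (modulo b w≈0 (solve 3 (λ b v w → v := v :- b :* w :+ b :* w) refl b v w)) v-bw≈0
          , w≈0

    nm≈0⇒im≈0 : ∀ {t} → nm t ≈ 0# → im t ≈ 0#
    nm≈0⇒im≈0 {t} nm≈0 = ≈0-stable λ im≉0 → Pos-sq im≉0 λ 0<im² →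
      absurd (Pos-* 0<D 0<im²) (sq≥0 (tr t))
        (trans (+-comm _ _) (trans (sym (4nm≈tr²+Dim² t)) (trans (*-congˡ nm≈0) (zeroʳ _))))

    -- The complex embedding is injective: if `nm` vanishes, so do `im` and then `re`, and these two
    -- determine the rational coordinates.
    norm≉0 : ∀ {t} → Entries Rational t → ¬ ev t ≈ 0# → ¬ norm t ≈ 0#
    norm≉0 {t@(⟨ u , v , w ⟩)} t∈ t≉0 norm≈0 = t≉0
      (≈0-+ (≈0-+ u≈0 (trans (*-congʳ v≈0) (zeroˡ α))) (trans (*-congʳ w≈0) (zeroˡ (α * α))))
      where
      nm≈0 : nm t ≈ 0#
      nm≈0 = integral (trans (sym (norm-factors t)) norm≈0) t≉0
      im≈0 : im t ≈ 0#
      im≈0 = nm≈0⇒im≈0 {t} nm≈0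
      v≈0 : v ≈ 0#
      v≈0 = proj₁ (rational⇒im≈0⇒v≈0×w≈0 t∈ im≈0)
      w≈0 : w ≈ 0#
      w≈0 = proj₂ (rational⇒im≈0⇒v≈0×w≈0 t∈ im≈0)
      re²≈0 : re t * re t ≈ 0#
      re²≈0 = trans (modulo (P * re t - Q * im t) im≈0
        (solve 4 (λ P Q r i → r :* r :=
            r :* r :- P :* r :* i :+ Q :* (i :* i) :+ (P :* r :- Q :* i) :* i)
            refl P Q (re t) (im t))) nm≈0
      re≈0 : re t ≈ 0#
      re≈0 = ≈0-stable λ re≉0 → re≉0 (integral re²≈0 re≉0)
      u≈0 : u ≈ 0#
      u≈0 = trans (modulo Q w≈0 (solve 3 (λ Q u w → u := u :- w :* Q :+ Q :* w) refl Q u w)) re≈0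

    -- The inverse of ev t is the product of the two other conjugates over the norm.
    ℚ[α]-inverse : ∀ {x y} → ℚ[α] x → x * y ≈ 1# → ℚ[α] y
    ℚ[α]-inverse {x} {y} (t , t∈ , t≈x) xy≈1 = resp-≈ (begin
        nm t * k                      ≈⟨ *-identityʳ (nm t * k) ⟨
        nm t * k * 1#                 ≈⟨ *-congˡ (trans (*-congʳ t≈x) xy≈1) ⟨
        nm t * k * (ev t * y)
          ≈⟨ solve 4 (λ n k e y → n :* k :* (e :* y) := e :* n :* k :* y) refl (nm t) k (ev t) y ⟩
        ev t * nm t * k * y           ≈⟨ *-congʳ (*-congʳ (norm-factors t)) ⟨
        norm t * k * y                ≈⟨ *-congʳ (proj₂ (proj₂ inv)) ⟩
        1# * y                        ≈⟨ *-identityˡ y ⟩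
        y                             ∎)
      (*∈ nm∈ (rational⊆ℚ[α] (proj₁ (proj₂ inv))))
      where
      open IsSubring ℚ[α]-isSubring

      x≉0 : ¬ ev t ≈ 0#
      x≉0 t≈0 = 1≉0 (trans (sym xy≈1) (trans (*-congʳ (trans (sym t≈x) t≈0)) (zeroˡ y)))

      inv : ∃[ k ] (Rational k × norm t * k ≈ 1#)
      inv = rational-inverse (ℚ³.norm-entries t∈) (norm≉0 t∈ x≉0)

      k : Carrier
      k = proj₁ inv

      P∈ : ℚ[α] P
      P∈ = +∈ (rational⊆ℚ[α] b∈ℚ) α∈ℚ[α]

      Q∈ : ℚ[α] Q
      Q∈ = +∈ (+∈ (rational⊆ℚ[α] c∈ℚ) (*∈ (rational⊆ℚ[α] b∈ℚ) α∈ℚ[α])) (*∈ α∈ℚ[α] α∈ℚ[α])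

      re∈ : ℚ[α] (re t)
      re∈ = +∈ (rational⊆ℚ[α] (proj₁ t∈)) (-∈ (*∈ (rational⊆ℚ[α] (proj₂ (proj₂ t∈))) Q∈))

      im∈ : ℚ[α] (im t)
      im∈ = +∈ (rational⊆ℚ[α] (proj₁ (proj₂ t∈))) (-∈ (*∈ (rational⊆ℚ[α] (proj₂ (proj₂ t∈))) P∈))

      nm∈ : ℚ[α] (nm t)
      nm∈ = +∈ (+∈ (*∈ re∈ re∈) (-∈ (*∈ (*∈ P∈ re∈) im∈))) (*∈ Q∈ (*∈ im∈ im∈))

    -- The conjugate of β = ev t is a zero of g = X³ + b X² + c X + e and of
    -- X² - (tr t) X + nm t, so the linear remainder of g modulo the latter
    -- vanishes, and β is a zero of the other factor X + b + tr t.
    module _ {e t} (t∈ : Entries Rational t) (gβ≈0 : cubic b c e (ev t) ≈ 0#)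
             (e∈ℚ : Rational e) (β∉ℚ : ¬ Rational (ev t)) where
      private
        -- `ev g` is g(β) = 0 and the coordinates of `g` are rational, so all of them vanish.
        -- Therefore `re g` and `im g` vanish too: the conjugate of β satisfies the same equation.
        g : Triple
        g = t ⊛ (t ⊛ t) ⊕ b ⊙ (t ⊛ t) ⊕ c ⊙ t ⊕ ⟨ e , 0# , 0# ⟩

        ev-const : ev ⟨ e , 0# , 0# ⟩ ≈ e
        ev-const = proj₂ (proj₂ (rational⊆ℚ[α] e∈ℚ))

        g∈ : Entries Rational g
        g∈ = ⊕-entries
            (⊕-entries (⊕-entries (⊛-entries t∈ (⊛-entries t∈ t∈))
            (⊙-entries b∈ℚ (⊛-entries t∈ t∈)))
                             (⊙-entries c∈ℚ t∈)) (e∈ℚ , ℚ-sub.0∈ , ℚ-sub.0∈)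
          where open ℚ³

        g≈0 : ev g ≈ 0#
        g≈0 = begin
          ev g
            ≈⟨ trans (ev-⊕ _ _) (+-cong (trans (ev-⊕ _ _) (+-cong (ev-⊕ _ _) (ev-⊙ c t)))
                ev-const) ⟩
          ev (t ⊛ (t ⊛ t)) + ev (b ⊙ (t ⊛ t)) + c * ev t + e
            ≈⟨ +-congʳ (+-congʳ (+-cong (trans (ev-⊛ t (t ⊛ t)) (*-congˡ (ev-⊛ t t)))
                (trans (ev-⊙ b (t ⊛ t)) (*-congˡ (ev-⊛ t t))))) ⟩
          ev t * (ev t * ev t) + b * (ev t * ev t) + c * ev t + e
            ≈⟨ +-congʳ (+-congʳ (+-congʳ (*-assoc (ev t) (ev t) (ev t)))) ⟨
          cubic b c e (ev t)
            ≈⟨ gβ≈0 ⟩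
          0#
            ∎

        ug≈0 : u g ≈ 0#
        ug≈0 = proj₁ (ev-injective₀ g∈ g≈0)
        vg≈0 : v g ≈ 0#
        vg≈0 = proj₁ (proj₂ (ev-injective₀ g∈ g≈0))
        wg≈0 : w g ≈ 0#
        wg≈0 = proj₂ (proj₂ (ev-injective₀ g∈ g≈0))

        vanish : ∀ x k → x ≈ 0# → w g ≈ 0# → x - w g * k ≈ 0#
        vanish x k x≈0 w≈0 = ≈0-+ x≈0 (≈0-neg (trans (*-congʳ w≈0) (zeroˡ k)))

        re-t² : re (t ⊛ t) ≈ re t * re t - Q * (im t * im t)
        re-t² = re-⊛ t t

        im-t² : im (t ⊛ t) ≈ tr t * im t
        im-t² = trans (im-⊛ t t) (solve 3 (λ P r i → r :* i :+ i :* r :- P :* (i :* i) :=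
            (con (+ 2) :* r :- P :* i) :* i) refl P (re t) (im t))

        re-const : re ⟨ e , 0# , 0# ⟩ ≈ e
        re-const = trans (+-congˡ (≈0-neg (zeroˡ Q))) (+-identityʳ e)

        im-const : im ⟨ e , 0# , 0# ⟩ ≈ 0#
        im-const = ≈0-+ refl (≈0-neg (zeroˡ P))

        g₃ g₂ g₁ g₀ : Triple
        g₃ = t ⊛ (t ⊛ t)
        g₂ = b ⊙ (t ⊛ t)
        g₁ = c ⊙ t
        g₀ = ⟨ e , 0# , 0# ⟩

        re-g : re g ≈ re t * re (t ⊛ t) - Q * (im t * im (t ⊛ t)) + b * re (t ⊛ t) + c * re t + e
        re-g = trans (re-⊕ (g₃ ⊕ g₂ ⊕ g₁) g₀) (+-cong (trans (re-⊕ (g₃ ⊕ g₂) g₁)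
          (+-cong (trans (re-⊕ g₃ g₂) (+-cong (re-⊛ t (t ⊛ t)) (re-⊙ b (t ⊛ t)))) (re-⊙ c t)))
              re-const)

        im-g : im g ≈ re t * im (t ⊛ t) + im t * re (t ⊛ t) - P * (im t * im (t ⊛ t))
            + b * im (t ⊛ t) + c * im t + 0#
        im-g = trans (im-⊕ (g₃ ⊕ g₂ ⊕ g₁) g₀) (+-cong (trans (im-⊕ (g₃ ⊕ g₂) g₁)
          (+-cong (trans (im-⊕ g₃ g₂) (+-cong (im-⊛ t (t ⊛ t)) (im-⊙ b (t ⊛ t)))) (im-⊙ c t)))
              im-const)

        -- The remainder of g modulo X² - (tr t) X + nm t.
        r₁ r₀ : Carrier
        r₁ = c - nm t + tr t * (b + tr t)
        r₀ = e - nm t * (b + tr t)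

      im≉0 : ¬ im t ≈ 0#
      im≉0 im≈0 = β∉ℚ (ℚ-sub.resp-≈ (sym (begin
        u t + v t * α + w t * (α * α)
          ≈⟨ +-cong (+-congˡ (trans (*-congʳ (proj₁ v,w≈0)) (zeroˡ α)))
              (trans (*-congʳ (proj₂ v,w≈0)) (zeroˡ (α * α))) ⟩
        u t + 0# + 0#                   ≈⟨ trans (+-identityʳ (u t + 0#)) (+-identityʳ (u t)) ⟩
        u t                             ∎)) (proj₁ t∈))
        where
        v,w≈0 : v t ≈ 0# × w t ≈ 0#
        v,w≈0 = rational⇒im≈0⇒v≈0×w≈0 t∈ im≈0

      private
        -- At Y = `re t + im t X` the quadratic divisor vanishes, so g(Y) = r₁ Y + r₀. The
        -- coefficient of X in it is `im t * r₁`, and the constant coefficient is `re t * r₁ + r₀`,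
        -- from which `r₀≈0` follows.
        r₁≈0 : r₁ ≈ 0#
        r₁≈0 = integral {im t} (begin
          im t * r₁
            ≈⟨ solve 6 (λ b c P Q r i →
                 let n = r :* r :- P :* r :* i :+ Q :* (i :* i)
                     τ = con (+ 2) :* r :- P :* i
                     r² = r :* r :- Q :* (i :* i)
                     i² = τ :* i
                 in i :* (c :- n :+ τ :* (b :+ τ)) :=
                    r :* i² :+ i :* r² :- P :* (i :* i²) :+ b :* i² :+ c :* i)
                        refl b c P Q (re t) (im t) ⟩
          re t * (tr t * im t) + im t * (re t * re t - Q * (im t * im t))
              - P * (im t * (tr t * im t)) + b * (tr t * im t) + c * im t
            ≈⟨ +-congʳ
                (+-cong (+-cong (+-cong (*-congˡ im-t²) (*-congˡ re-t²))
                (-‿cong (*-congˡ (*-congˡ im-t²)))) (*-congˡ im-t²)) ⟨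
          re t * im (t ⊛ t) + im t * re (t ⊛ t) - P * (im t * im (t ⊛ t)) + b * im (t ⊛ t)
              + c * im t
            ≈⟨ +-identityʳ _ ⟨
          re t * im (t ⊛ t) + im t * re (t ⊛ t) - P * (im t * im (t ⊛ t)) + b * im (t ⊛ t)
              + c * im t + 0#
            ≈⟨ im-g ⟨
          im g
            ≈⟨ vanish (v g) P vg≈0 wg≈0 ⟩
          0# ∎) im≉0

        r₀≈0 : r₀ ≈ 0#
        r₀≈0 = begin
          r₀
            ≈⟨ modulo (- re t) r₁≈0 (solve 7 (λ b c e P Q r i →
                 let n = r :* r :- P :* r :* i :+ Q :* (i :* i)
                     τ = con (+ 2) :* r :- P :* i
                     r² = r :* r :- Q :* (i :* i)
                     i² = τ :* i
                 in e :- n :* (b :+ τ) :=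
                    (r :* r² :- Q :* (i :* i²) :+ b :* r² :+ c :* r :+ e)
                        :+ :- r :* (c :- n :+ τ :* (b :+ τ))) refl b c e P Q (re t) (im t)) ⟩
          re t * (re t * re t - Q * (im t * im t)) - Q * (im t * (tr t * im t))
              + b * (re t * re t - Q * (im t * im t)) + c * re t + e
            ≈⟨ +-congʳ (+-congʳ (+-cong (+-cong (*-congˡ re-t²) (-‿cong (*-congˡ (*-congˡ im-t²))))
                (*-congˡ re-t²))) ⟨
          re t * re (t ⊛ t) - Q * (im t * im (t ⊛ t)) + b * re (t ⊛ t) + c * re t + e
            ≈⟨ re-g ⟨
          re g
            ≈⟨ vanish (u g) Q ug≈0 wg≈0 ⟩
          0# ∎

        β : Carrier
        β = ev t

      tr≈-b-β : tr t ≈ - (b + β)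
      tr≈-b-β = x-y≈0⇒x≈y (trans (solve 3 (λ b β τ → τ :- :- (b :+ β) := b :+ τ :+ β)
          refl b β (tr t))
        (integral {β * β - tr t * β + nm t}
          (trans (modulo (- β) r₁≈0 (trans (solve 6 (λ b c e β τ n →
              (β :* β :- τ :* β :+ n) :* (b :+ τ :+ β) :=
              cubicᵖ b c e β :+ :- β :* (c :- n :+ τ :* (b :+ τ)) :- (e :- n :* (b :+ τ)))
                  refl b c e β (tr t) (nm t))
            (trans (+-congˡ (≈0-neg r₀≈0)) (+-identityʳ _)))) gβ≈0)
          -- The quadratic factor is nonzero at β: four times its value is (2β - tr)² + D im², which
          -- is positive.
          λ q≈0 → Pos-sq im≉0 λ 0<im² → absurd (Pos-* 0<D 0<im²) (sq≥0 (int (+ 2) * β - tr t))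
            (begin
              D * (im t * im t) + (int (+ 2) * β - tr t) * (int (+ 2) * β - tr t)
                ≈⟨ solve 3 (λ d β τ → d :+ (con (+ 2) :* β :- τ) :* (con (+ 2) :* β :- τ) :=
                    (τ :* τ :+ d) :+ con (+ 4) :* (β :* β :- τ :* β)) refl _ β (tr t) ⟩
              (tr t * tr t + D * (im t * im t)) + int (+ 4) * (β * β - tr t * β)
                ≈⟨ +-congʳ (4nm≈tr²+Dim² t) ⟨
              int (+ 4) * nm t + int (+ 4) * (β * β - tr t * β)
                ≈⟨ solve 3 (λ β τ n → con (+ 4) :* n :+ con (+ 4) :* (β :* β :- τ :* β) :=
                    con (+ 4) :* (β :* β :- τ :* β :+ n)) refl β (tr t) (nm t) ⟩
              int (+ 4) * (β * β - tr t * β + nm t)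
                ≈⟨ trans (*-congˡ q≈0) (zeroʳ _) ⟩
              0# ∎)))

      -- Both sides are the negated discriminant of the cofactor of X - β in g, on the left
      -- expressed by trace and norm of the conjugate of β. So `im t` is a signed square root of
      -- D(β)/D(α) that already lies in the algebra.
      Dim²≈disc-β : D * (im t * im t) ≈ disc b c β
      Dim²≈disc-β = begin
        D * (im t * im t)
          ≈⟨ solve 2 (λ d τ → d := (τ :* τ :+ d) :- τ :* τ) refl _ (tr t) ⟩
        (tr t * tr t + D * (im t * im t)) - tr t * tr t
          ≈⟨ +-congʳ (4nm≈tr²+Dim² t) ⟨
        int (+ 4) * nm t - tr t * tr t
          ≈⟨ modulo (int (ℤ.- (+ 4))) r₁≈0 (solve 4 (λ b c τ n →
               con (+ 4) :* n :- τ :* τ :=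
               con (+ 4) :* c :+ con (+ 4) :* (τ :* (b :+ τ)) :- τ :* τ
                   :+ con (ℤ.- (+ 4)) :* (c :- n :+ τ :* (b :+ τ))) refl b c (tr t) (nm t)) ⟩
        int (+ 4) * c + int (+ 4) * (tr t * (b + tr t)) - tr t * tr t
          ≈⟨ +-cong (+-congˡ (*-congˡ (*-cong tr≈-b-β (+-congˡ tr≈-b-β))))
              (-‿cong (*-cong tr≈-b-β tr≈-b-β)) ⟩
        int (+ 4) * c + int (+ 4) * (- (b + β) * (b + - (b + β))) - - (b + β) * - (b + β)
          ≈⟨ solve 3 (λ b c β → con (+ 4) :* c :+ con (+ 4) :* (:- (b :+ β) :* (b :+ :- (b :+ β)))
              :- :- (b :+ β) :* :- (b :+ β) := discᵖ b c β) refl b c β ⟩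
        disc b c β ∎

  -- Integrality of norms

  ≢0-* : ∀ {i j} → i ≢ 0ℤ → j ≢ 0ℤ → i ℤ.* j ≢ 0ℤ
  ≢0-* {i} i≢0 j≢0 ij≡0 = [ i≢0 , j≢0 ]′ (ℤ.i*j≡0⇒i≡0∨j≡0 i ij≡0)

  clear-denominators : ∀ {x y z} → Rational x → Rational y → Rational z →
    ∃[ L ] (L ≢ 0ℤ × Integral (int L * x) × Integral (int L * y) × Integral (int L * z))
  clear-denominators {x} {y} {z} x∈ y∈ z∈ =
    let dx , dx≢0 , ix = clear-denominator x∈
        dy , dy≢0 , iy = clear-denominator y∈
        dz , dz≢0 , iz = clear-denominator z∈
        L≈ = trans (int-* (dx ℤ.* dy) dz) (*-congʳ (int-* dx dy))
    in dx ℤ.* dy ℤ.* dz , ≢0-* (≢0-* dx≢0 dy≢0) dz≢0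
     , ℤ-sub.resp-≈ (sym (trans (*-congʳ L≈) (solve 4 (λ x a b c → a :* b :* c :* x :=
         b :* c :* (a :* x)) refl x (int dx) (int dy) (int dz))))
         (ℤ-sub.*∈ (ℤ-sub.*∈ (ℤ-sub.int∈ dy) (ℤ-sub.int∈ dz)) ix)
     , ℤ-sub.resp-≈ (sym (trans (*-congʳ L≈) (solve 4 (λ x a b c → a :* b :* c :* x :=
         a :* c :* (b :* x)) refl y (int dx) (int dy) (int dz))))
         (ℤ-sub.*∈ (ℤ-sub.*∈ (ℤ-sub.int∈ dx) (ℤ-sub.int∈ dz)) iy)
     , ℤ-sub.resp-≈ (sym (trans (*-congʳ L≈) (solve 4 (λ x a b c → a :* b :* c :* x :=
         a :* b :* (c :* x)) refl z (int dx) (int dy) (int dz))))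
         (ℤ-sub.*∈ (ℤ-sub.*∈ (ℤ-sub.int∈ dx) (ℤ-sub.int∈ dy)) iz)

  module Integrality {b c d α} (α-root : IrrationalRoot b c d α) where
    open IrrationalRoot α-root
    open CubicField α-root

    ev-injective : ∀ {s t} → Entries Rational s → Entries Rational t → ev s ≈ ev t →
                   u s ≈ u t × v s ≈ v t × w s ≈ w t
    ev-injective {s} {t} (us , vs , ws) (ut , vt , wt) s≈t =
      let u≈ , v≈ , w≈ = ev-injective₀ {⟨ u s - u t , v s - v t , w s - w t ⟩}
            (ℚ-sub.+∈ us (ℚ-sub.-∈ ut) , ℚ-sub.+∈ vs (ℚ-sub.-∈ vt) , ℚ-sub.+∈ ws (ℚ-sub.-∈ wt))
            (trans (solve 7 (λ α a b c d e f →
               (a :- d) :+ (b :- e) :* α :+ (c :- f) :* (α :* α) :=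
               (a :+ b :* α :+ c :* (α :* α)) :- (d :+ e :* α :+ f :* (α :* α)))
               refl α (u s) (v s) (w s) (u t) (v t) (w t)) (x≈y⇒x-y≈0 s≈t))
      in x-y≈0⇒x≈y u≈ , x-y≈0⇒x≈y v≈ , x-y≈0⇒x≈y w≈

    norm-cong : ∀ {s t} → u s ≈ u t → v s ≈ v t → w s ≈ w t → norm s ≈ norm t
    norm-cong {s} {t} u≈ v≈ w≈ = trans (norm-factors s) (trans
      (*-cong (+-cong (+-cong u≈ (*-congʳ v≈)) (*-congʳ w≈))
              (nm-cong {s} {t} (+-cong u≈ (-‿cong (*-congʳ w≈))) (+-cong v≈ (-‿cong (*-congʳ w≈)))))
      (sym (norm-factors t)))

    norm-⊙ : ∀ k t → norm (k ⊙ t) ≈ k * k * k * norm t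
    norm-⊙ k t = begin
      norm (k ⊙ t)
        ≈⟨ norm-factors (k ⊙ t) ⟩
      ev (k ⊙ t) * nm (k ⊙ t)
        ≈⟨ *-cong (ev-⊙ k t) (+-cong (+-cong (*-cong (re-⊙ k t) (re-⊙ k t))
             (-‿cong (*-cong (*-congˡ (re-⊙ k t)) (im-⊙ k t))))
                 (*-congˡ (*-cong (im-⊙ k t) (im-⊙ k t)))) ⟩
      k * ev t * (k * re t * (k * re t) - P * (k * re t) * (k * im t) + Q * (k * im t * (k * im t)))
        ≈⟨ solve 6 (λ P Q k e r i →
             k :* e :* (k :* r :* (k :* r) :- P :* (k :* r) :* (k :* i)
                 :+ Q :* (k :* i :* (k :* i))) :=
             k :* k :* k :* (e :* (r :* r :- P :* r :* i :+ Q :* (i :* i))))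
                 refl P Q k (ev t) (re t) (im t) ⟩
      k * k * k * (ev t * nm t)
        ≈⟨ *-congˡ (norm-factors t) ⟨
      k * k * k * norm t
        ∎

    1ᵗ : Triple
    1ᵗ = ⟨ 1# , 0# , 0# ⟩

    pow : Triple → ℕ → Triple
    pow t zero    = 1ᵗ
    pow t (suc k) = t ⊛ pow t k

    ev-1ᵗ : ev 1ᵗ ≈ 1#
    ev-1ᵗ = proj₂ (proj₂ (rational⊆ℚ[α] ℚ-sub.1∈))

    norm-1ᵗ : norm 1ᵗ ≈ 1#
    norm-1ᵗ = trans (norm-factors 1ᵗ) (trans (*-cong ev-1ᵗ (nm-1 re-1 im-1)) (*-identityˡ 1#))
      where
      re-1 : re 1ᵗ ≈ 1#
      re-1 = trans (+-congˡ (≈0-neg (zeroˡ Q))) (+-identityʳ 1#)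
      im-1 : im 1ᵗ ≈ 0#
      im-1 = ≈0-+ refl (≈0-neg (zeroˡ P))
      nm-1 : ∀ {r i} → r ≈ 1# → i ≈ 0# → r * r - P * r * i + Q * (i * i) ≈ 1#
      nm-1 {r} {i} r≈1 i≈0 = trans (modulo (Q * i - P * r) i≈0
        (solve 4 (λ P Q r i → r :* r :- P :* r :* i :+ Q :* (i :* i) :=
            r :* r :+ (Q :* i :- P :* r) :* i) refl P Q r i))
        (trans (*-cong r≈1 r≈1) (*-identityˡ 1#))

    pow-rational : ∀ {t} → Entries Rational t → ∀ k → Entries Rational (pow t k)
    pow-rational t∈ zero    = ℚ-sub.1∈ , ℚ-sub.0∈ , ℚ-sub.0∈
    pow-rational {t} t∈ (suc k) = ℚ³.⊛-entries {t} {pow t k} t∈ (pow-rational t∈ k)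

    ev-pow : ∀ t k → ev (pow t k) ≈ ev t ^ k
    ev-pow t zero    = ev-1ᵗ
    ev-pow t (suc k) = trans (ev-⊛ t (pow t k)) (*-congˡ (ev-pow t k))

    norm-pow : ∀ t k → norm (pow t k) ≈ norm t ^ k
    norm-pow t zero    = norm-1ᵗ
    norm-pow t (suc k) = trans (norm-⊛ t (pow t k)) (*-congˡ (norm-pow t k))

    ℤ[α] : Pred Carrier 0ℓ
    ℤ[α] x = ∃[ t ] (Entries Integral t × ev t ≈ x)

    ℤ[α]-resp-≈ : ∀ {x y} → x ≈ y → ℤ[α] x → ℤ[α] y
    ℤ[α]-resp-≈ x≈y (t , t∈ , t≈x) = t , t∈ , trans t≈x x≈y

    ℤ[α]-+ : ∀ {x y} → ℤ[α] x → ℤ[α] y → ℤ[α] (x + y)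
    ℤ[α]-+ (s , s∈ , s≈x) (t , t∈ , t≈y) =
      s ⊕ t , ℤ³.⊕-entries s∈ t∈ , trans (ev-⊕ s t) (+-cong s≈x t≈y)

    ℤ[α]-int* : ∀ i {x} → ℤ[α] x → ℤ[α] (int i * x)
    ℤ[α]-int* i (t , t∈ , t≈x) = int i ⊙ t
      , ℤ³.⊙-entries (ℤ-sub.int∈ i) t∈ , trans (ev-⊙ (int i) t) (*-congˡ t≈x)

    ℤ[α]-integral* : ∀ {k x} → Integral k → ℤ[α] x → ℤ[α] (k * x)
    ℤ[α]-integral* (i , k≈i) x∈ = ℤ[α]-resp-≈ (*-congʳ (sym k≈i)) (ℤ[α]-int* i x∈)

    ℤ[α]-α* : ∀ {x} → ℤ[α] x → ℤ[α] (α * x)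
    ℤ[α]-α* (t , t∈ , t≈x) =
      α⊛ t , ℤ³.α⊛-entries t∈ , trans (ev-α⊛ t) (*-congˡ t≈x)

    ℤ[α]-neg : ∀ {x} → ℤ[α] x → ℤ[α] (- x)
    ℤ[α]-neg {x} x∈ = ℤ[α]-resp-≈ (solve 1 (λ x → con -1ℤ :* x := :- x) refl x) (ℤ[α]-int* -1ℤ x∈)

    denominator : ∀ {x} → ℚ[α] x → ∃[ L ] (L ≢ 0ℤ × ℤ[α] (int L * x))
    denominator (t , (u∈ , v∈ , w∈) , t≈x) =
      let L , L≢0 , Lu , Lv , Lw = clear-denominators u∈ v∈ w∈
      in L , L≢0 , int L ⊙ t , (Lu , Lv , Lw) , trans (ev-⊙ (int L) t) (*-congˡ t≈x)

    -- All powers of an element of ℤ[α, β] have a common denominator L, as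
    -- they lie in the lattice of those y with L y, L y β, L y β² ∈ ℤ[α].
    module Lattice {β e} (β∈ : ℚ[α] β) (e∈ℤ : Integral e) (gβ≈0 : cubic b c e β ≈ 0#) where

      Λ : ℤ → Pred Carrier 0ℓ
      Λ L y = ℤ[α] (int L * y) × ℤ[α] (int L * (y * β)) × ℤ[α] (int L * (y * (β * β)))

      Λ-1 : ∃[ L ] (L ≢ 0ℤ × Λ L 1#)
      Λ-1 =
        let L₁ , L₁≢0 , L₁β∈ = denominator β∈
            L₂ , L₂≢0 , L₂β²∈ = denominator (IsSubring.*∈ ℚ[α]-isSubring β∈ β∈)
            1∈ = 1ᵗ , (ℤ-sub.1∈ , ℤ-sub.0∈ , ℤ-sub.0∈) , ev-1ᵗ
        in L₁ ℤ.* L₂ , ≢0-* L₁≢0 L₂≢0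
         , ℤ[α]-int* (L₁ ℤ.* L₂) 1∈
         , ℤ[α]-resp-≈ (trans (solve 3 (λ k l x → l :* (k :* x) := k :* l :* (con 1ℤ :* x))
             refl (int L₁) (int L₂) β)
             (*-cong (sym (int-* L₁ L₂)) (*-congʳ ι-1))) (ℤ[α]-int* L₂ L₁β∈)
         , ℤ[α]-resp-≈ (trans (solve 3 (λ k l x → k :* (l :* x) := k :* l :* (con 1ℤ :* x))
             refl (int L₁) (int L₂) (β * β))
             (*-cong (sym (int-* L₁ L₂)) (*-congʳ ι-1))) (ℤ[α]-int* L₁ L₂β²∈)

      module Multipliers (L : ℤ) where
        -- The multiplier ring of the lattice. It contains ℤ and α because they preserve ℤ[α], and β
        -- because g reduces β³ to lower powers.
        Stable : Pred Carrier 0ℓ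
        Stable x = ∀ {y} → Λ L y → Λ L (x * y)

        private
          ℓ : Carrier
          ℓ = int L

        Λ-resp-≈ : ∀ {x y} → x ≈ y → Λ L x → Λ L y
        Λ-resp-≈ x≈y (x₀ , x₁ , x₂) =
          ℤ[α]-resp-≈ (*-congˡ x≈y) x₀ , ℤ[α]-resp-≈ (*-congˡ (*-congʳ x≈y)) x₁ , ℤ[α]-resp-≈
              (*-congˡ (*-congʳ x≈y)) x₂

        Λ-+ : ∀ {x y} → Λ L x → Λ L y → Λ L (x + y)
        Λ-+ {x} {y} (x₀ , x₁ , x₂) (y₀ , y₁ , y₂) =
            ℤ[α]-resp-≈ (sym (distribˡ ℓ x y)) (ℤ[α]-+ x₀ y₀)
          , ℤ[α]-resp-≈ (distrib₂ ℓ x y β) (ℤ[α]-+ x₁ y₁)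
          , ℤ[α]-resp-≈ (distrib₂ ℓ x y (β * β)) (ℤ[α]-+ x₂ y₂)
          where
          distrib₂ : ∀ l x y z → l * (x * z) + l * (y * z) ≈ l * ((x + y) * z)
          distrib₂ = solve 4 (λ l x y z → l :* (x :* z) :+ l :* (y :* z) :=
              l :* ((x :+ y) :* z)) refl

        private
          swap₁ : ∀ l k x → k * (l * x) ≈ l * (k * x)
          swap₁ = solve 3 (λ l k x → k :* (l :* x) := l :* (k :* x)) refl

          swap₂ : ∀ l k x z → k * (l * (x * z)) ≈ l * (k * x * z)
          swap₂ = solve 4 (λ l k x z → k :* (l :* (x :* z)) := l :* (k :* x :* z)) refl

        stable-int : ∀ i → Stable (int i)
        stable-int i {y} (y₀ , y₁ , y₂) =
            ℤ[α]-resp-≈ (swap₁ ℓ (int i) y) (ℤ[α]-int* i y₀)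
          , ℤ[α]-resp-≈ (swap₂ ℓ (int i) y β) (ℤ[α]-int* i y₁)
          , ℤ[α]-resp-≈ (swap₂ ℓ (int i) y (β * β)) (ℤ[α]-int* i y₂)

        stable-α : Stable α
        stable-α {y} (y₀ , y₁ , y₂) =
            ℤ[α]-resp-≈ (swap₁ ℓ α y) (ℤ[α]-α* y₀)
          , ℤ[α]-resp-≈ (swap₂ ℓ α y β) (ℤ[α]-α* y₁)
          , ℤ[α]-resp-≈ (swap₂ ℓ α y (β * β)) (ℤ[α]-α* y₂)

        stable-β : Stable β
        stable-β {y} (y₀ , y₁ , y₂) =
            ℤ[α]-resp-≈ (*-congˡ (*-comm y β)) y₁
          , ℤ[α]-resp-≈ (solve 3 (λ l y β → l :* (y :* (β :* β)) := l :* (β :* y :* β)) refl ℓ y β)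
              y₂
          , ℤ[α]-resp-≈ (sym (modulo (ℓ * y) gβ≈0 (solve 6 (λ b c e l y β →
                l :* (β :* y :* (β :* β)) :=
                :- (b :* (l :* (y :* (β :* β))) :+ c :* (l :* (y :* β)) :+ e :* (l :* y))
                    :+ l :* y :* cubicᵖ b c e β)
                refl b c e ℓ y β)))
              (ℤ[α]-neg (ℤ[α]-+ (ℤ[α]-+ (ℤ[α]-integral* b∈ℤ y₂) (ℤ[α]-integral* c∈ℤ y₁))
                  (ℤ[α]-integral* e∈ℤ y₀)))

        stable-+ : ∀ {x y} → Stable x → Stable y → Stable (x + y)
        stable-+ {x} {y} x∈ y∈ {z} z∈ = Λ-resp-≈ (sym (distribʳ z x y)) (Λ-+ (x∈ z∈) (y∈ z∈))

        stable-* : ∀ {x y} → Stable x → Stable y → Stable (x * y)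
        stable-* {x} {y} x∈ y∈ {z} z∈ = Λ-resp-≈ (sym (*-assoc x y z)) (x∈ (y∈ z∈))

        stable-^ : ∀ {x} → Stable x → Λ L 1# → ∀ k → Λ L (x ^ k)
        stable-^ x∈ 1∈ zero    = 1∈
        stable-^ x∈ 1∈ (suc k) = x∈ (stable-^ x∈ 1∈ k)

        -- For x = `ev t` each L x^k lies in ℤ[α], so its norm L³ N(x)^k is an integer. Uniqueness
        -- of coordinates is what identifies the integral coordinates of L x^k with the rational
        -- ones used for the norm.
        stable⇒norm-integral : ∀ {t} → L ≢ 0ℤ → Λ L 1# → Entries Rational t → Stable (ev t) →
            Integral (norm t)
        stable⇒norm-integral {t} L≢0 1∈ t∈ stable =
          integrally-closed (ℚ³.norm-entries {t} t∈) (≢0-* (≢0-* L≢0 L≢0) L≢0) λ k →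
            let s , s∈@(us , vs , ws) , s≈ = proj₁ (stable-^ stable 1∈ k)
                u≈ , v≈ , w≈ = ev-injective {s} {ℓ ⊙ pow t k}
                  (integral⊆rational us , integral⊆rational vs , integral⊆rational ws)
                  (ℚ³.⊙-entries {ℓ} {pow t k} (ℚ-sub.int∈ L) (pow-rational t∈ k))
                  (trans s≈ (sym (trans (ev-⊙ ℓ (pow t k)) (*-congˡ (ev-pow t k)))))
            in ℤ-sub.resp-≈ (begin
                 norm s                              ≈⟨ norm-cong {s} {ℓ ⊙ pow t k} u≈ v≈ w≈ ⟩
                 norm (ℓ ⊙ pow t k)                  ≈⟨ norm-⊙ ℓ (pow t k) ⟩
                 ℓ * ℓ * ℓ * norm (pow t k)
                   ≈⟨ *-cong (sym (trans (int-* (L ℤ.* L) L) (*-congʳ (int-* L L))))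
                       (norm-pow t k) ⟩
                 int (L ℤ.* L ℤ.* L) * norm t ^ k    ∎)
                 (ℤ³.norm-entries s∈)

    -- The norm of pα + qβ + k, written as the product of its real embedding
    -- with |complex embedding|² = (trace² + D · im²) / 4.
    norm-of-combination : ∀ {e t} (t∈ : Entries Rational t) (e∈ℤ : Integral e)
        (gβ≈0 : cubic b c e (ev t) ≈ 0#)
      (β∉ℚ : ¬ Rational (ev t)) (p q k : ℤ) → ∃[ n ]
      let β = ev t
          trace = - (int p * (b + α) + int q * (b + β)) + int (+ 2) * int k
          imag = int p + int q * im t
          value = int p * α + int q * β + int k
      in int (+ 4) * int n ≈ value * (trace * trace + D * (imag * imag)) × (value ≈ 0# → trace ≈ 0#)
    norm-of-combination {e} {t} t∈ e∈ℤ gβ≈0 β∉ℚ p q k = proj₁ N∈ , (begin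
      int (+ 4) * int (proj₁ N∈)
        ≈⟨ *-congˡ (proj₂ N∈) ⟨
      int (+ 4) * norm x
        ≈⟨ trans (*-congˡ (norm-factors x)) (solve 2 (λ e n → con (+ 4) :* (e :* n) :=
            e :* (con (+ 4) :* n)) refl (ev x) (nm x)) ⟩
      ev x * (int (+ 4) * nm x)
        ≈⟨ *-congˡ (4nm≈tr²+Dim² x) ⟩
      ev x * (tr x * tr x + D * (im x * im x))
        ≈⟨ *-cong ev-x (+-cong (*-cong tr-x tr-x) (*-congˡ (*-cong im-x im-x))) ⟩
      (int p * α + int q * ev t + int k) * (trace * trace + D * (imag * imag))
        ∎) , λ value≈0 → trans (sym tr-x) (tr≈0 (ev-injective₀ x∈ (trans ev-x value≈0)))
      where
      trace imag : Carrier
      trace = - (int p * (b + α) + int q * (b + ev t)) + int (+ 2) * int k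
      imag = int p + int q * im t

      x : Triple
      x = ⟨ int q * u t + int k , int q * v t + int p , int q * w t ⟩

      x∈ : Entries Rational x
      x∈ = ℚ-sub.+∈ (ℚ-sub.*∈ (ℚ-sub.int∈ q) (proj₁ t∈)) (ℚ-sub.int∈ k)
         , ℚ-sub.+∈ (ℚ-sub.*∈ (ℚ-sub.int∈ q) (proj₁ (proj₂ t∈))) (ℚ-sub.int∈ p)
         , ℚ-sub.*∈ (ℚ-sub.int∈ q) (proj₂ (proj₂ t∈))

      ev-x : ev x ≈ int p * α + int q * ev t + int k
      ev-x = solve 7 (λ α p q k u v w →
        (q :* u :+ k) :+ (q :* v :+ p) :* α :+ (q :* w) :* (α :* α) :=
        p :* α :+ q :* (u :+ v :* α :+ w :* (α :* α)) :+ k)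
            refl α (int p) (int q) (int k) (u t) (v t) (w t)

      im-x : im x ≈ imag
      im-x = solve 5 (λ P p q v w → (q :* v :+ p) :- (q :* w) :* P := p :+ q :* (v :- w :* P))
          refl P (int p) (int q) (v t) (w t)

      tr-x : tr x ≈ trace
      tr-x = trans
        (solve 8 (λ P Q p q k u v w →
           con (+ 2) :* ((q :* u :+ k) :- (q :* w) :* Q) :- P :* ((q :* v :+ p) :- (q :* w) :* P) :=
           :- (p :* P) :+ q :* (con (+ 2) :* (u :- w :* Q) :- P :* (v :- w :* P)) :+ con (+ 2) :* k)
           refl P Q (int p) (int q) (int k) (u t) (v t) (w t))
        (trans (+-congʳ (+-congˡ (*-congˡ (tr≈-b-β t∈ gβ≈0 (integral⊆rational e∈ℤ) β∉ℚ))))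
          (solve 5 (λ P B p q k → :- (p :* P) :+ q :* (:- B) :+ con (+ 2) :* k :=
              :- (p :* P :+ q :* B) :+ con (+ 2) :* k)
            refl P (b + ev t) (int p) (int q) (int k)))

      -- A vanishing value has vanishing coordinates, and so a vanishing complex embedding.
      tr≈0 : u x ≈ 0# × v x ≈ 0# × w x ≈ 0# → tr x ≈ 0#
      tr≈0 (u≈0 , v≈0 , w≈0) = trans (modulo (P * P - int (+ 2) * Q) w≈0
          (solve 5 (λ P Q u v w →
             con (+ 2) :* (u :- w :* Q) :- P :* (v :- w :* P) :=
             con (+ 2) :* u :- P :* v :+ (P :* P :- con (+ 2) :* Q) :* w)
                 refl P Q (u x) (v x) (w x)))
        (≈0-+ (trans (*-congˡ u≈0) (zeroʳ _)) (≈0-neg (trans (*-congˡ v≈0) (zeroʳ P))))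

      β∈ : ℚ[α] (ev t)
      β∈ = t , t∈ , refl

      open Lattice β∈ e∈ℤ gβ≈0

      L : ℤ
      L = proj₁ Λ-1

      open Multipliers L

      stable : Stable (int p * α + int q * ev t + int k)
      stable = stable-+ {int p * α + int q * ev t} {int k}
        (stable-+ {int p * α} {int q * ev t}
          (stable-* {int p} {α} (stable-int p) stable-α) (stable-* {int q} {ev t} (stable-int q)
              stable-β))
        (stable-int k)

      N∈ : Integral (norm x)
      N∈ = stable⇒norm-integral (proj₁ (proj₂ Λ-1)) (proj₂ (proj₂ Λ-1)) x∈
        λ y∈ → Λ-resp-≈ (*-congʳ (sym ev-x)) (stable y∈)

  -- Estimates

  infix 4 _≤_
  _≤_ : Carrier → Carrier → Set
  x ≤ y = (y - x) ≥0

  int-mono-≤ : ∀ {i j} → i ℤ.≤ j → int i ≤ int j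
  int-mono-≤ {i} {j} i≤j = ≥0-resp-≈ (trans (int-+ j (ℤ.- i)) (+-congˡ (int-neg i)))
      (int-≥0 {j ℤ.- i} (ℤ.i≤j⇒0≤j-i i≤j))

  Pos-int : ∀ n → Pos (int (+ suc n))
  Pos-int n = int-pos {+ suc n} (ℤ.+<+ (ℕ.s≤s ℕ.z≤n))

  ℕ≥0 : ∀ n → int (+ n) ≥0
  ℕ≥0 n = int-≥0 {+ n} (+≤+ ℕ.z≤n)

  -- A common denominator of 1, x, x² is one for all powers of x, by the recurrence of length three
  -- that the monic cubic provides.
  rational-root-integral : ∀ {b c d x} → Integral b → Integral c → Integral d →
    cubic b c d x ≈ 0# → Rational x → Integral x
  rational-root-integral {b} {c} {d} {x} b∈ c∈ d∈ fx≈0 x∈ =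
    let L , L≢0 , L₀ , L₁ , L₂ = clear-denominators ℚ-sub.1∈ x∈ (ℚ-sub.*∈ x∈ x∈)
    in integrally-closed x∈ L≢0 λ k → proj₁ (powers L L₀
         (ℤ-sub.resp-≈ (*-congˡ (sym (*-identityʳ x))) L₁)
         (ℤ-sub.resp-≈ (*-congˡ (*-congˡ (sym (*-identityʳ x)))) L₂) k)
    where
    powers : ∀ L → Integral (int L * x ^ 0) → Integral (int L * x ^ 1) → Integral (int L * x ^ 2) →
             ∀ k → Integral (int L * x ^ k) × Integral (int L * x ^ suc k) × Integral
                 (int L * x ^ suc (suc k))
    powers L L₀ L₁ L₂ zero    = L₀ , L₁ , L₂
    powers L L₀ L₁ L₂ (suc k) =
      let i₀ , i₁ , i₂ = powers L L₀ L₁ L₂ k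
      in i₁ , i₂ , ℤ-sub.resp-≈ (sym (modulo (int L * x ^ k) fx≈0 (solve 6 (λ b c d x l y →
           l :* (x :* (x :* (x :* y))) :=
           :- (b :* (l :* (x :* (x :* y))) :+ c :* (l :* (x :* y)) :+ d :* (l :* y))
               :+ l :* y :* cubicᵖ b c d x)
           refl b c d x (int L) (x ^ k))))
         (ℤ-sub.-∈ (ℤ-sub.+∈ (ℤ-sub.+∈ (ℤ-sub.*∈ b∈ i₂) (ℤ-sub.*∈ c∈ i₁)) (ℤ-sub.*∈ d∈ i₀)))

  ¬integral-between-0-1 : ∀ {x} → Pos x → Pos (int 1ℤ - x) → ¬ Integral x
  ¬integral-between-0-1 {x} 0<x x<1 (i , x≈i) =
    absurd x<1 (int-mono-≤ {1ℤ} {i} (ℤ.i<j⇒suc[i]≤j (int-reflects-pos (Pos-resp-≈ x≈i 0<x))))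
      (trans (+-congˡ (+-congʳ (sym x≈i)))
        (trans (solve 1 (λ x → (con 1ℤ :- x) :+ (x :- con 1ℤ) := con 0ℤ) refl x) ι-0))

  -- disc b c x - 4 = m (3 - m) + m (1 - x)² + (3 - m) x² + 4 (c - m - 1) for m = -b.
  disc≥4 : ∀ {b c} x → b ≤ 0# → int (ℤ.- (+ 3)) ≤ b → (- b + int 1ℤ) ≤ c → int (+ 4) ≤ disc b c x
  disc≥4 {b} {c} x b≤0 -3≤b 1-b≤c = ≥0-resp-≈
    (trans (+-congʳ (+-congʳ (+-cong (*-congʳ m-0) (*-congʳ m-0))))
      (solve 3 (λ b c x →
        (:- b :* (b :- con (ℤ.- (+ 3))) :+ :- b :* ((con 1ℤ :- x) :* (con 1ℤ :- x)))
        :+ (b :- con (ℤ.- (+ 3))) :* (x :* x) :+ con (+ 4) :* (c :- (:- b :+ con 1ℤ)) :=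
        discᵖ b c x :- con (+ 4)) refl b c x))
    (≥0-+ (≥0-+ (≥0-+ (≥0-* b≤0 -3≤b) (≥0-* b≤0 (sq≥0 (int 1ℤ - x)))) (≥0-* -3≤b (sq≥0 x)))
        (≥0-* (ℕ≥0 4) 1-b≤c))
    where
    m-0 : 0# - b ≈ - b
    m-0 = +-identityˡ (- b)

  -- With A² = D and B² = D τ² this says 16 (A - B)² ≤ (A² - B²)², which holds as A + B ≥ 4.
  gap-bound : ∀ {D τ} → int (+ 4) ≤ D → int (+ 4) ≤ D * (τ * τ) → Pos τ →
    int (+ 16) * (D * ((int 1ℤ - τ) * (int 1ℤ - τ))) ≤ (D - D * (τ * τ)) * (D - D * (τ * τ))
  gap-bound {D} {τ} 4≤D 4≤Dτ² 0<τ = ≥0-resp-≈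
    (solve 2 (λ D τ →
      D :* ((con 1ℤ :- τ) :* (con 1ℤ :- τ)) :*
        ((D :- con (+ 4)) :+ (D :* (τ :* τ) :- con (+ 4)) :+ con (+ 2) :* (D :* τ :- con (+ 4))) :=
      (D :- D :* (τ :* τ)) :* (D :- D :* (τ :* τ))
          :- con (+ 16) :* (D :* ((con 1ℤ :- τ) :* (con 1ℤ :- τ)))) refl D τ)
    (≥0-* (≥0-* D≥0 (sq≥0 (int 1ℤ - τ))) (≥0-+ (≥0-+ 4≤D 4≤Dτ²) (≥0-* (ℕ≥0 2) 4≤Dτ)))
    where
    D≥0 : D ≥0
    D≥0 = ≥0-resp-≈ (solve 1 (λ D → (D :- con (+ 4)) :+ con (+ 4) := D) refl D) (≥0-+ 4≤D (ℕ≥0 4))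

    4≤Dτ : int (+ 4) ≤ D * τ
    -- The product of D and D τ², both at least 4, is (D τ)², so (D τ)² ≥ 16; positivity of τ
    -- selects the root.
    4≤Dτ Dτ<4 = Pos-+-≥0 (Pos-int 3) (≥0-* D≥0 (Pos-asym 0<τ)) λ 0<4+Dτ → absurd (Pos-* Dτ<4 0<4+Dτ)
      (≥0-+ (≥0-+ (≥0-* 4≤D 4≤Dτ²) (≥0-* (ℕ≥0 4) 4≤D)) (≥0-* (ℕ≥0 4) 4≤Dτ²))
      (trans (solve 2 (λ D τ →
        (:- (D :* τ :- con (+ 4))) :* (con (+ 4) :+ D :* τ) :+
          ((D :- con (+ 4)) :* (D :* (τ :* τ) :- con (+ 4)) :+ con (+ 4) :* (D :- con (+ 4))
              :+ con (+ 4) :* (D :* (τ :* τ) :- con (+ 4))) :=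
        con 0ℤ) refl D τ) ι-0)

  small-multiple-of-4 : ∀ n {z y} → Pos (int 1ℤ - z) → Pos (int 1ℤ + z) → y ≥0 →
      Pos (int (+ 4) - y) →
    int (+ 4) * int n ≈ z * y → z * y ≈ 0#
  small-multiple-of-4 n {z} {y} z<1 -1<z y≥0 y<4 4n≈zy with ℤ.<-cmp n 0ℤ
  ... | tri≈ _ ≡.refl _ = trans (sym 4n≈zy) (trans (*-congˡ ι-0) (zeroʳ _))
  ... | tri< n<0 _ _ = ⊥-elim (absurd y<4
    (≥0-+ (≥0-* (Pos-asym -1<z) y≥0) (≥0-* (ℕ≥0 4) (int-mono-≤ {n} { -1ℤ } (ℤ.i<j⇒i≤pred[j] n<0))))
    (trans (modulo (int -1ℤ) (x≈y⇒x-y≈0 4n≈zy) (solve 3 (λ n z y →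
      (con (+ 4) :- y) :+ ((con 1ℤ :+ z) :* y :+ con (+ 4) :* (con -1ℤ :- n)) :=
      con 0ℤ :+ con -1ℤ :* (con (+ 4) :* n :- z :* y)) refl (int n) z y)) ι-0))
  ... | tri> _ _ 0<n = ⊥-elim (absurd y<4
    (≥0-+ (≥0-* (Pos-asym z<1) y≥0) (≥0-* (ℕ≥0 4) (int-mono-≤ {1ℤ} {n} (ℤ.i<j⇒suc[i]≤j 0<n))))
    (trans (modulo (int 1ℤ) (x≈y⇒x-y≈0 4n≈zy) (solve 3 (λ n z y →
      (con (+ 4) :- y) :+ ((con 1ℤ :- z) :* y :+ con (+ 4) :* (n :- con 1ℤ)) :=
      con 0ℤ :+ con 1ℤ :* (con (+ 4) :* n :- z :* y)) refl (int n) z y)) ι-0))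

  Pos-cancel : ∀ k {x} → Pos (int (+ suc k) * x) → ¬ ¬ Pos x
  Pos-cancel k {x} 0<kx x≯0 = absurd 0<kx
    (≥0-* (ℕ≥0 (suc k)) λ 0<--x → x≯0 (Pos-resp-≈ (solve 1 (λ x → :- :- x := x) refl x) 0<--x))
    (trans (solve 2 (λ k x → k :* x :+ k :* :- x := con 0ℤ) refl (int (+ suc k)) x) ι-0)

  -- From m² ≤ 36 follows 16 (δ² + E) ≤ 52 δ² < 64, so four times the squared absolute value of the
  -- conjugate is below 4. The constant 12 in the certificate is 64 - 52.
  difference-norm : ∀ n {δ m E} → Pos (int 1ℤ - δ) → Pos (int 1ℤ + δ) → m * m ≤ int (+ 36) → E ≥0 →
    int (+ 16) * E ≤ (δ * m) * (δ * m) → int (+ 4) * int n ≈ δ * (δ * δ + E) → ¬ ¬ δ ≈ 0#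
  difference-norm n {δ} {m} {E} δ<1 -1<δ m²≤36 E≥0 16E≤δ²m² 4n≈δy δ≉0 =
    Pos-+-≥0 (Pos-int 11) (≥0-+ (≥0-+ 16E≤δ²m² (≥0-* (sq≥0 δ) m²≤36))
        (≥0-* (ℕ≥0 52) (Pos-asym (Pos-* δ<1 -1<δ)))) λ 0<16[4-y] →
    Pos-cancel 15 (Pos-resp-≈ (solve 3 (λ δ m E →
      con (+ 12) :+ (δ :* m :* (δ :* m) :- con (+ 16) :* E :+ δ :* δ :* (con (+ 36) :- m :* m)
          :+ con (+ 52) :* ((con 1ℤ :- δ) :* (con 1ℤ :+ δ))) :=
      con (+ 16) :* (con (+ 4) :- (δ :* δ :+ E))) refl δ m E) 0<16[4-y]) λ y<4 →
    Pos-sq δ≉0 λ 0<δ² → absurd 0<δ² E≥0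
      (integral (small-multiple-of-4 n δ<1 -1<δ (≥0-+ (sq≥0 δ) E≥0) y<4 4n≈δy) δ≉0)

  -- For 0 < s < 2 one has (3 s - 2)² ≤ 16, since 16 - (3 s - 2)² = 3 (2 - s) (3 s + 2). Hence E ≤
  -- δ² ≤ (2 - s)², and s² + (2 - s)² = 4 - 2 s (2 - s) is below 4.
  shifted-sum-norm : ∀ n {s δ E} → Pos s → Pos (int (+ 2) - s) →
      δ * δ ≤ (int (+ 2) - s) * (int (+ 2) - s) → E ≥0 →
    int (+ 16) * E ≤ (δ * (int (+ 3) * s - int (+ 2))) * (δ * (int (+ 3) * s - int (+ 2))) →
    int (+ 4) * int n ≈ (s - int 1ℤ) * (s * s + E) → ¬ ¬ s - int 1ℤ ≈ 0#
  shifted-sum-norm n {s} {δ} {E} 0<s s<2 δ²≤[2-s]² E≥0 16E≤ 4n≈zy z≉0 =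
    Pos-+-≥0 (Pos-* (Pos-int 31) (Pos-* 0<s s<2))
      (≥0-+ (≥0-+ (≥0-* (ℕ≥0 16) δ²≤[2-s]²)
        (≥0-* (sq≥0 δ) (≥0-* (Pos-asym (Pos-* (Pos-int 2) s<2))
            (≥0-+ (≥0-* (ℕ≥0 3) (Pos-asym 0<s)) (ℕ≥0 2)))))
        16E≤) λ 0<16[4-y] →
    Pos-cancel 15 (Pos-resp-≈ (solve 3 (λ s δ E →
      con (+ 32) :* (s :* (con (+ 2) :- s)) :+
        (con (+ 16) :* ((con (+ 2) :- s) :* (con (+ 2) :- s) :- δ :* δ)
         :+ δ :* δ :* (con (+ 3) :* (con (+ 2) :- s) :* (con (+ 3) :* s :+ con (+ 2)))
         :+ ((δ :* (con (+ 3) :* s :- con (+ 2))) :* (δ :* (con (+ 3) :* s :- con (+ 2)))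
             :- con (+ 16) :* E)) :=
      con (+ 16) :* (con (+ 4) :- (s :* s :+ E))) refl s δ E) 0<16[4-y]) λ y<4 →
    absurd (Pos-* 0<s 0<s) E≥0
      (integral (small-multiple-of-4 n
        (Pos-resp-≈ (solve 1 (λ s → con (+ 2) :- s := con 1ℤ :- (s :- con 1ℤ)) refl s) s<2)
        (Pos-resp-≈ (solve 1 (λ s → s := con 1ℤ :+ (s :- con 1ℤ)) refl s) 0<s)
        (≥0-+ (sq≥0 s) E≥0) y<4 4n≈zy) z≉0)

  -- γ and 1 - γ would have norms 1 and n′ ∈ (-2, -1), the two inequalities
  -- resulting from 4/3 < z < 8/5.
  module _ (n n′ : ℤ) {z δ E} (0<z : Pos z) (z<2 : Pos (int (+ 2) - z))
    (δ²≤[2-z]² : δ * δ ≤ (int (+ 2) - z) * (int (+ 2) - z)) (δ²≤1 : δ * δ ≤ int 1ℤ) (E≥0 : E ≥0)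
    (16E≤9δ²z² : int (+ 16) * E ≤ (δ * (int (+ 3) * z)) * (δ * (int (+ 3) * z)))
    (4n≈zy : int (+ 4) * int n ≈ z * (z * z + E))
    (4n′≈ : int (+ 4) * int n′ ≈ (int 1ℤ - z) * ((z + int (+ 2)) * (z + int (+ 2)) + E)) where

    private
      y : Carrier
      y = z * z + E

      z≥0 : z ≥0
      z≥0 = Pos-asym 0<z

      0<y : ¬ ¬ Pos y
      0<y = Pos-+-≥0 (Pos-* 0<z 0<z) E≥0

      y<4 : ¬ ¬ Pos (int (+ 4) - y)
      -- As z (2 - z) = 1 - (1 - z)² ≤ 1, one gets 16 E ≤ 9 z² (2 - z)² ≤ 9 z (2 - z), and 64 - 16
      -- z² - 9 z (2 - z) is at least 64 - 18 z - 7 z² = (2 - z) (7 z + 32).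
      y<4 y≮4 = Pos-+-≥0 (Pos-* z<2 0<7z+32)
        (≥0-+ (≥0-+ 16E≤9δ²z² (≥0-* (≥0-* (ℕ≥0 9) (sq≥0 z)) δ²≤[2-z]²))
          (≥0-* (≥0-* (≥0-* (ℕ≥0 9) z≥0) (Pos-asym z<2)) (sq≥0 (int 1ℤ - z))))
        λ 0<16[4-y] → Pos-cancel 15 (Pos-resp-≈ (solve 3 (λ z δ E →
          (con (+ 2) :- z) :* (con (+ 7) :* z :+ con (+ 32)) :+
            ((δ :* (con (+ 3) :* z)) :* (δ :* (con (+ 3) :* z)) :- con (+ 16) :* E
             :+ con (+ 9) :* (z :* z) :* ((con (+ 2) :- z) :* (con (+ 2) :- z) :- δ :* δ)
             :+ con (+ 9) :* z :* (con (+ 2) :- z) :* ((con 1ℤ :- z) :* (con 1ℤ :- z))) :=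
          con (+ 16) :* (con (+ 4) :- (z :* z :+ E))) refl z δ E) 0<16[4-y]) y≮4
        where
        0<7z+32 : Pos (int (+ 7) * z + int (+ 32))
        0<7z+32 = Pos-+ (Pos-* (Pos-int 6) 0<z) (Pos-int 31)

      n≡1 : ¬ ¬ n ≡ 1ℤ
      n≡1 n≢1 = 0<y λ 0<y → y<4 λ y<4 → helper 0<y y<4
        where
        helper : Pos y → Pos (int (+ 4) - y) → ⊥
        helper 0<y y<4 with ℤ.<-cmp n 1ℤ
        ... | tri≈ _ n≡1 _ = n≢1 n≡1
        ... | tri< n<1 _ _ =
            absurd (Pos-* 0<z 0<y) (≥0-* (ℕ≥0 4) (int-mono-≤ {n} {0ℤ} (ℤ.i<j⇒i≤pred[j] n<1)))
          (trans (modulo (int -1ℤ) (x≈y⇒x-y≈0 4n≈zy) (solve 3 (λ n z y →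
            z :* y :+ con (+ 4) :* (con 0ℤ :- n) := con 0ℤ :+ con -1ℤ :* (con (+ 4) :* n :- z :* y))
            refl (int n) z y)) ι-0)
        ... | tri> _ _ 1<n = absurd (Pos-* (Pos-int 1) y<4)
          (≥0-+ (Pos-asym (Pos-* z<2 0<y))
              (≥0-* (ℕ≥0 4) (int-mono-≤ {+ 2} {n} (ℤ.i<j⇒suc[i]≤j 1<n))))
          (trans (modulo (int 1ℤ) (x≈y⇒x-y≈0 4n≈zy) (solve 3 (λ n z y →
            con (+ 2) :* (con (+ 4) :- y)
                :+ ((con (+ 2) :- z) :* y :+ con (+ 4) :* (n :- con (+ 2))) :=
            con 0ℤ :+ con 1ℤ :* (con (+ 4) :* n :- z :* y)) refl (int n) z y)) ι-0)

      module _ (4≈zy : z * y - int (+ 4) ≈ 0#) where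
        -- z³ ≤ z y = 4 < (8/5)³; the constant 12 is 512 - 4 · 125.
        z<8/5 : ¬ ¬ Pos (- (int (+ 5) * z - int (+ 8)))
        z<8/5 k≥0 = absurd (Pos-int 11)
          (≥0-+ (≥0-* k≥0 (≥0-+ (≥0-+ (sq≥0 k) (≥0-* (ℕ≥0 24) k≥0)) (ℕ≥0 192)))
              (≥0-* (ℕ≥0 125) (≥0-* z≥0 E≥0)))
          (trans (modulo (int (+ 125)) 4≈zy (solve 2 (λ z E →
            let k = con (+ 5) :* z :- con (+ 8)
            in con (+ 12) :+ (k :* (k :* k :+ con (+ 24) :* k :+ con (+ 192))
                :+ con (+ 125) :* (z :* E)) :=
               con 0ℤ :+ con (+ 125) :* (z :* (z :* z :+ E) :- con (+ 4))) refl z E)) ι-0)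
          where
          k : Carrier
          k = int (+ 5) * z - int (+ 8)

        -- 16 E ≤ 9 z² gives 64 = 16 z y ≤ 25 z³, whereas 25 (4/3)³ < 64; the constant 128 is 27 ·
        -- 64 - 25 · 64.
        4/3<z : ¬ ¬ Pos (- (int (+ 4) - int (+ 3) * z))
        4/3<z k≥0 = absurd (Pos-int 127)
          (≥0-+ (≥0-+ (≥0-* (ℕ≥0 25) (≥0-* k≥0 (≥0-+ (≥0-* (ℕ≥0 36) z≥0) (sq≥0 k))))
                      (≥0-* (ℕ≥0 27) (≥0-* z≥0 16E≤9δ²z²)))
                (≥0-* (ℕ≥0 243) (≥0-* (≥0-* z≥0 (sq≥0 z)) δ²≤1)))
          (trans (modulo (int (ℤ.- (+ 432))) 4≈zy (solve 3 (λ z δ E →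
            let k = con (+ 4) :- con (+ 3) :* z
            in con (+ 128) :+ (con (+ 25) :* (k :* (con (+ 36) :* z :+ k :* k))
                 :+ con (+ 27) :* (z :* ((δ :* (con (+ 3) :* z)) :* (δ :* (con (+ 3) :* z))
                     :- con (+ 16) :* E))
                 :+ con (+ 243) :* (z :* (z :* z) :* (con 1ℤ :- δ :* δ))) :=
               con 0ℤ :+ con (ℤ.- (+ 432)) :* (z :* (z :* z :+ E) :- con (+ 4))) refl z δ E)) ι-0)
          where
          k : Carrier
          k = int (+ 4) - int (+ 3) * z

        4n′≈E-3z² : int (+ 4) * int n′ ≈ E - int (+ 3) * (z * z)
        4n′≈E-3z² = trans 4n′≈ (modulo (int -1ℤ) 4≈zy (solve 2 (λ z E →
          (con 1ℤ :- z) :* ((z :+ con (+ 2)) :* (z :+ con (+ 2)) :+ E) :=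
          E :- con (+ 3) :* (z :* z) :+ con -1ℤ :* (z :* (z :* z :+ E) :- con (+ 4))) refl z E))

        -- That is, n′ = 1/z - z² with the denominator cleared.
        z4n′≈4-4z³ : z * (int (+ 4) * int n′) - (int (+ 4) - int (+ 4) * (z * (z * z))) ≈ 0#
        z4n′≈4-4z³ = trans (+-congʳ (*-congˡ 4n′≈E-3z²))
            (trans (modulo (int 1ℤ) 4≈zy (solve 2 (λ z E →
          z :* (E :- con (+ 3) :* (z :* z)) :- (con (+ 4) :- con (+ 4) :* (z :* (z :* z))) :=
          con 0ℤ :+ con 1ℤ :* (z :* (z :* z :+ E) :- con (+ 4))) refl z E)) ι-0)

        -- n′ ≥ -1 would mean z³ ≤ z + 1, which fails from 4/3 on; n′ ≤ -2 would mean z³ ≥ 2 z + 1,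
        -- which needs z to be at least the golden ratio, above 8/5. The constants 4 and 52 measure
        -- the failure at 4/3 and at 8/5.
        no-integer : Pos (- (int (+ 5) * z - int (+ 8))) → Pos (- (int (+ 4) - int (+ 3) * z)) → ⊥
        no-integer 0<h 0<k with -1ℤ ℤ.≤? n′
        ... | yes -1≤n′ = absurd (Pos-int 3)
          (≥0-+ (≥0-* (≥0-* (ℕ≥0 4) (Pos-asym 0<k))
              (≥0-+ (≥0-+ (sq≥0 _) (≥0-* (ℕ≥0 12) (Pos-asym 0<k))) (ℕ≥0 39)))
            (≥0-* (ℕ≥0 27) (≥0-* z≥0 (≥0-* (ℕ≥0 4) (int-mono-≤ { -1ℤ } {n′} -1≤n′)))))
          (trans (modulo (int (+ 27)) z4n′≈4-4z³ (solve 2 (λ z n →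
            let k = :- (con (+ 4) :- con (+ 3) :* z)
            in con (+ 4) :+ (con (+ 4) :* k :* (k :* k :+ con (+ 12) :* k :+ con (+ 39))
                :+ con (+ 27) :* (z :* (con (+ 4) :* (n :- con -1ℤ)))) :=
               con 0ℤ :+ con (+ 27) :* (z :* (con (+ 4) :* n)
                   :- (con (+ 4) :- con (+ 4) :* (z :* (z :* z))))) refl z (int n′))) ι-0)
        ... | no -1≰n′ = absurd (Pos-int 51)
          (≥0-+ (≥0-* (≥0-* (ℕ≥0 4) (Pos-asym 0<h)) (≥0-+ (≥0-+ (ℕ≥0 14) (≥0-* (ℕ≥0 40) z≥0))
              (≥0-* (ℕ≥0 25) (sq≥0 z))))
            (≥0-* (ℕ≥0 125)
                (≥0-* z≥0
                (≥0-* (ℕ≥0 4) (int-mono-≤ {n′} { -[1+ 1 ]} (ℤ.i<j⇒i≤pred[j] (ℤ.≰⇒> -1≰n′)))))))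
          (trans (modulo (int (ℤ.- (+ 125))) z4n′≈4-4z³ (solve 2 (λ z n →
            let h = :- (con (+ 5) :* z :- con (+ 8))
            in con (+ 52)
                :+ (con (+ 4) :* h :* (con (+ 14) :+ con (+ 40) :* z :+ con (+ 25) :* (z :* z))
                :+ con (+ 125) :* (z :* (con (+ 4) :* (con (ℤ.- (+ 2)) :- n)))) :=
               con 0ℤ :+ con (ℤ.- (+ 125)) :* (z :* (con (+ 4) :* n)
                   :- (con (+ 4) :- con (+ 4) :* (z :* (z :* z))))) refl z (int n′))) ι-0)

    sum-norm : ⊥
    sum-norm = n≡1 λ n≡1 →
      let 4≈zy = trans (+-congʳ (sym 4n≈zy)) (trans (+-congʳ (*-congˡ (reflexive (≡.cong int n≡1))))
            (trans (solve 0 (con (+ 4) :* con 1ℤ :- con (+ 4) := con 0ℤ) refl) ι-0))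
      in z<8/5 4≈zy λ 0<h → 4/3<z 4≈zy λ 0<k → no-integer 4≈zy 0<h 0<k

  cubic-cong : ∀ {b c d x y} → x ≈ y → cubic b c d x ≈ cubic b c d y
  cubic-cong x≈y = +-congʳ (+-cong (+-cong (*-cong (*-cong x≈y x≈y) x≈y) (*-congˡ (*-cong x≈y x≈y)))
      (*-congˡ x≈y))

  -- Roots of two cubics that share the coefficients b and c

  module _ {b c : ℤ} (-3≤b : ℤ.- (+ 3) ℤ.≤ b) (b≤0 : b ℤ.≤ 0ℤ) (1-b≤c : ℤ.- b ℤ.+ 1ℤ ℤ.≤ c) where

    4≤disc : ∀ x → int (+ 4) ≤ disc (int b) (int c) x
    4≤disc x = disc≥4 x
      (≥0-resp-≈ (+-congʳ ι-0) (int-mono-≤ {b} {0ℤ} b≤0))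
      (int-mono-≤ {ℤ.- (+ 3)} {b} -3≤b)
      (≥0-resp-≈ (+-congˡ (-‿cong (trans (int-+ (ℤ.- b) 1ℤ) (+-congʳ (int-neg b)))))
          (int-mono-≤ {ℤ.- b ℤ.+ 1ℤ} {c} 1-b≤c))

    irrationalRoot : ∀ {d α} → Pos α → Pos (int 1ℤ - α) → cubic (int b) (int c) (int d) α ≈ 0# →
      ¬ ¬ IrrationalRoot (int b) (int c) (int d) α
    irrationalRoot {d} {α} 0<α α<1 fα≈0 ¬root = Pos-+-≥0 (Pos-int 3) (4≤disc α) λ 0<D → ¬root record
      { b∈ℤ = ℤ-sub.int∈ b
      ; c∈ℤ = ℤ-sub.int∈ c
      ; d∈ℤ = ℤ-sub.int∈ d
      ; fα≈0 = fα≈0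
      ; 0<D = Pos-resp-≈ (solve 1 (λ D → con (+ 4) :+ (D :- con (+ 4)) := D) refl _) 0<D
      ; α∉ℚ = λ α∈ℚ → ¬integral-between-0-1 0<α α<1
          (rational-root-integral (ℤ-sub.int∈ b) (ℤ-sub.int∈ c) (ℤ-sub.int∈ d) fα≈0 α∈ℚ)
      }

    module TwoRoots {d e : ℤ} {α} (α-root : IrrationalRoot (int b) (int c) (int d) α) where
      open CubicField α-root
      open Integrality α-root

      module _ {t} (t∈ : Entries Rational t) (gβ≈0 : cubic (int b) (int c) (int e) (ev t) ≈ 0#)
          (β∉ℚ : ¬ Rational (ev t))
        (0<α : Pos α) (α<1 : Pos (int 1ℤ - α)) (0<β : Pos (ev t)) (β<1 : Pos (int 1ℤ - ev t)) where

        -- σ = Im β′ / Im α′ for the images α′, β′ of α, β under a complex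
        -- embedding.  An integral combination of small norm is δ = α - β if
        -- σ > 0, and α + β shifted by an integer if σ < 0.
        β s δ m σ : Carrier
        β = ev t
        s = α + β
        δ = α - β
        m = int (+ 2) * int b + int (+ 3) * s
        σ = im t

        β-norm : (p q k : ℤ) → _
        β-norm = norm-of-combination t∈ (ℤ-sub.int∈ e) gβ≈0 β∉ℚ

        Dσ²≈disc-β : D * (σ * σ) ≈ disc (int b) (int c) β
        Dσ²≈disc-β = Dim²≈disc-β t∈ gβ≈0 (integral⊆rational (ℤ-sub.int∈ e)) β∉ℚ

        D-Dσ²≈δm : D - D * (σ * σ) ≈ δ * m
        D-Dσ²≈δm = trans (+-congˡ (-‿cong Dσ²≈disc-β)) (solve 4 (λ b c α β →
          discᵖ b c α :- discᵖ b c β := (α :- β) :* (con (+ 2) :* b :+ con (+ 3) :* (α :+ β)))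
              refl (int b) (int c) α β)

        -- For τ = |σ| this is (√D(α) - √D(β))². It is also four times the squared imaginary part of
        -- the conjugate of α - β if σ > 0, and of α + β if σ < 0.
        E : Carrier → Carrier
        E τ = D * ((int 1ℤ - τ) * (int 1ℤ - τ))

        E≥0 : ∀ τ → E τ ≥0
        E≥0 τ = ≥0-* (≥0-resp-≈ (solve 1 (λ D → (D :- con (+ 4)) :+ con (+ 4) := D) refl D)
            (≥0-+ (4≤disc α) (ℕ≥0 4))) (sq≥0 _)

        16E≤δ²m² : ∀ {τ} → Pos τ → τ * τ ≈ σ * σ → int (+ 16) * E τ ≤ (δ * m) * (δ * m)
        16E≤δ²m² {τ} 0<τ τ²≈σ² = ≥0-resp-≈
          (+-congʳ (*-cong D-Dτ²≈δm D-Dτ²≈δm))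
          (gap-bound (4≤disc α) (≥0-resp-≈ (+-congʳ (sym (trans (*-congˡ τ²≈σ²) Dσ²≈disc-β)))
              (4≤disc β)) 0<τ)
          where
          D-Dτ²≈δm : D - D * (τ * τ) ≈ δ * m
          D-Dτ²≈δm = trans (+-congˡ (-‿cong (*-congˡ τ²≈σ²))) D-Dσ²≈δm

        0<s : Pos s
        0<s = Pos-+ 0<α 0<β

        s<2 : Pos (int (+ 2) - s)
        s<2 = Pos-resp-≈ (solve 2 (λ α β → (con 1ℤ :- α) :+ (con 1ℤ :- β) := con (+ 2) :- (α :+ β))
            refl α β) (Pos-+ α<1 β<1)

        δ<1 : Pos (int 1ℤ - δ)
        δ<1 = Pos-resp-≈ (solve 2 (λ α β → (con 1ℤ :- α) :+ β := con 1ℤ :- (α :- β)) refl α β)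
            (Pos-+ α<1 0<β)

        -1<δ : Pos (int 1ℤ + δ)
        -1<δ = Pos-resp-≈ (solve 2 (λ α β → α :+ (con 1ℤ :- β) := con 1ℤ :+ (α :- β)) refl α β)
            (Pos-+ 0<α β<1)

        δ²≤1 : δ * δ ≤ int 1ℤ
        δ²≤1 = ≥0-resp-≈ (solve 1 (λ δ → (con 1ℤ :- δ) :* (con 1ℤ :+ δ) := con 1ℤ :- δ :* δ) refl δ)
            (Pos-asym (Pos-* δ<1 -1<δ))

        δ²≤[2-s]² : δ * δ ≤ (int (+ 2) - s) * (int (+ 2) - s)
        δ²≤[2-s]² = ≥0-resp-≈
          (solve 2 (λ α β → con (+ 4) :* ((con 1ℤ :- α) :* (con 1ℤ :- β)) :=
                            (con (+ 2) :- (α :+ β)) :* (con (+ 2) :- (α :+ β))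
                                :- (α :- β) :* (α :- β)) refl α β)
          (≥0-* (ℕ≥0 4) (Pos-asym (Pos-* α<1 β<1)))

        δ²≤[2-[2-s]]² : δ * δ ≤ (int (+ 2) - (int (+ 2) - s)) * (int (+ 2) - (int (+ 2) - s))
        δ²≤[2-[2-s]]² = ≥0-resp-≈
          (solve 2 (λ α β → con (+ 4) :* (α :* β) :=
                            (con (+ 2) :- (con (+ 2) :- (α :+ β))) :* (con (+ 2)
                                :- (con (+ 2) :- (α :+ β))) :- (α :- β) :* (α :- β)) refl α β)
          (≥0-* (ℕ≥0 4) (Pos-asym (Pos-* 0<α 0<β)))

        2-s<2 : Pos (int (+ 2) - (int (+ 2) - s))
        2-s<2 = Pos-resp-≈ (solve 1 (λ s → s := con (+ 2) :- (con (+ 2) :- s)) refl s) 0<s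

        same-orientation : Pos σ → ¬ ¬ δ ≈ 0#
        same-orientation 0<σ =
          let n , 4n≈ , _ = β-norm 1ℤ -1ℤ 0ℤ
          in difference-norm n {δ} {m} {E σ} δ<1 -1<δ
               (≥0-resp-≈ (solve 1 (λ m → (con (+ 6) :- m) :* (con (+ 6) :+ m) :=
                   con (+ 36) :- m :* m) refl m) (≥0-* m≤6 -6≤m))
               (E≥0 σ) (16E≤δ²m² 0<σ refl)
               (trans 4n≈ (solve 5 (λ b α β D σ →
                  (con 1ℤ :* α :+ con -1ℤ :* β :+ con 0ℤ) :*
                    ((:- (con 1ℤ :* (b :+ α) :+ con -1ℤ :* (b :+ β)) :+ con (+ 2) :* con 0ℤ) :*
                     (:- (con 1ℤ :* (b :+ α) :+ con -1ℤ :* (b :+ β)) :+ con (+ 2) :* con 0ℤ)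
                     :+ D :* ((con 1ℤ :+ con -1ℤ :* σ) :* (con 1ℤ :+ con -1ℤ :* σ))) :=
                  (α :- β) :* ((α :- β) :* (α :- β) :+ D :* ((con 1ℤ :- σ) :* (con 1ℤ :- σ))))
                      refl (int b) α β D σ))
          where
          m≤6 : (int (+ 6) - m) ≥0
          m≤6 = ≥0-resp-≈
              (solve 2 (λ b s → con (+ 2) :* (con 0ℤ :- b) :+ con (+ 3) :* (con (+ 2) :- s) :=
                                            con (+ 6) :- (con (+ 2) :* b :+ con (+ 3) :* s))
                                                refl (int b) s)
            (≥0-+ (≥0-* (ℕ≥0 2) (int-mono-≤ {b} {0ℤ} b≤0)) (≥0-* (ℕ≥0 3) (Pos-asym s<2)))
          -6≤m : (int (+ 6) + m) ≥0
          -6≤m = ≥0-resp-≈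
              (solve 2 (λ b s → con (+ 2) :* (b :- con (ℤ.- (+ 3))) :+ con (+ 3) :* s :=
                                             con (+ 6) :+ (con (+ 2) :* b :+ con (+ 3) :* s))
                                                 refl (int b) s)
            (≥0-+ (≥0-* (ℕ≥0 2) (int-mono-≤ {ℤ.- (+ 3)} {b} -3≤b)) (≥0-* (ℕ≥0 3) (Pos-asym 0<s)))

        module _ (σ<0 : Pos (- σ)) where
          F : Carrier
          F = E (- σ)

          16F≤δ²m² : int (+ 16) * F ≤ (δ * m) * (δ * m)
          16F≤δ²m² = 16E≤δ²m² σ<0 (solve 1 (λ σ → :- σ :* :- σ := σ :* σ) refl σ)

          private
            normᵖ : ∀ {k} (p q r : ℤ) (b α β D σ : Polynomial k) → Polynomial k
            normᵖ p q r b α β D σ =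
              (con p :* α :+ con q :* β :+ con r) :*
                ((:- (con p :* (b :+ α) :+ con q :* (b :+ β)) :+ con (+ 2) :* con r) :*
                 (:- (con p :* (b :+ α) :+ con q :* (b :+ β)) :+ con (+ 2) :* con r)
                 :+ D :* ((con p :+ con q :* σ) :* (con p :+ con q :* σ)))

            Fᵖ : ∀ {k} (D σ : Polynomial k) → Polynomial k
            Fᵖ D σ = D :* ((con 1ℤ :- :- σ) :* (con 1ℤ :- :- σ))

          -- For γ = α + β the complex trace is -γ, and for 1 - γ it is γ + 2; moreover m = 3γ.
          -- These are the shapes that `sum-norm` expects.
          opposite-orientation-0 : b ≡ 0ℤ → ⊥
          opposite-orientation-0 ≡.refl =
            let n , 4n≈ , _ = β-norm 1ℤ 1ℤ 0ℤ
                n′ , 4n′≈ , _ = β-norm -1ℤ -1ℤ 1ℤ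
            in sum-norm n n′ {s} {δ} {F} 0<s s<2 δ²≤[2-s]² δ²≤1 (E≥0 (- σ))
                 (≥0-resp-≈ (solve 3 (λ δ s F →
                    (δ :* (con (+ 2) :* con 0ℤ :+ con (+ 3) :* s))
                        :* (δ :* (con (+ 2) :* con 0ℤ :+ con (+ 3) :* s)) :- con (+ 16) :* F :=
                    (δ :* (con (+ 3) :* s)) :* (δ :* (con (+ 3) :* s)) :- con (+ 16) :* F)
                        refl δ s F) 16F≤δ²m²)
                 (trans 4n≈ (solve 4 (λ α β D σ → normᵖ 1ℤ 1ℤ 0ℤ (con 0ℤ) α β D σ :=
                    (α :+ β) :* ((α :+ β) :* (α :+ β) :+ Fᵖ D σ)) refl α β D σ))
                 (trans 4n′≈ (solve 4 (λ α β D σ → normᵖ -1ℤ -1ℤ 1ℤ (con 0ℤ) α β D σ :=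
                    (con 1ℤ :- (α :+ β)) :* (((α :+ β) :+ con (+ 2)) :* ((α :+ β) :+ con (+ 2))
                        :+ Fᵖ D σ)) refl α β D σ))

          -- The mirror image under x ↦ 1 - x: for γ = 2 - s the complex traces of γ and 1 - γ are
          -- again -γ and γ + 2, and m = -3γ.
          opposite-orientation-3 : b ≡ -[1+ 2 ] → ⊥
          opposite-orientation-3 ≡.refl =
            let n , 4n≈ , _ = β-norm -1ℤ -1ℤ (+ 2)
                n′ , 4n′≈ , _ = β-norm 1ℤ 1ℤ -1ℤ
            in sum-norm n n′ {int (+ 2) - s} {δ} {F} s<2 2-s<2 δ²≤[2-[2-s]]² δ²≤1 (E≥0 (- σ))
                 (≥0-resp-≈ (solve 3 (λ δ s F →
                    (δ :* (con (+ 2) :* con -[1+ 2 ] :+ con (+ 3) :* s))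
                        :* (δ :* (con (+ 2) :* con -[1+ 2 ] :+ con (+ 3) :* s))
                        :- con (+ 16) :* F :=
                    (δ :* (con (+ 3) :* (con (+ 2) :- s))) :* (δ :* (con (+ 3) :* (con (+ 2) :- s)))
                        :- con (+ 16) :* F) refl δ s F) 16F≤δ²m²)
                 (trans 4n≈ (solve 4 (λ α β D σ → normᵖ -1ℤ -1ℤ (+ 2) (con -[1+ 2 ]) α β D σ :=
                    (con (+ 2) :- (α :+ β)) :* ((con (+ 2) :- (α :+ β)) :* (con (+ 2) :- (α :+ β))
                        :+ Fᵖ D σ)) refl α β D σ))
                 (trans 4n′≈ (solve 4 (λ α β D σ → normᵖ 1ℤ 1ℤ -1ℤ (con -[1+ 2 ]) α β D σ :=
                    (con 1ℤ :- (con (+ 2) :- (α :+ β))) :*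
                      (((con (+ 2) :- (α :+ β)) :+ con (+ 2)) :* ((con (+ 2) :- (α :+ β))
                          :+ con (+ 2)) :+ Fᵖ D σ)) refl α β D σ))

          -- The shift by -1 moves the value of α + β into (-1, 1) and at the same time turns its
          -- complex trace 2 - s into -s.
          opposite-orientation-1 : b ≡ -1ℤ → ⊥
          opposite-orientation-1 ≡.refl =
            let n , 4n≈ , value≈0⇒trace≈0 = β-norm 1ℤ 1ℤ -1ℤ
            in shifted-sum-norm n {s} {δ} {F} 0<s s<2 δ²≤[2-s]² (E≥0 (- σ))
                 (≥0-resp-≈ (solve 3 (λ δ s F →
                    (δ :* (con (+ 2) :* con -1ℤ :+ con (+ 3) :* s))
                        :* (δ :* (con (+ 2) :* con -1ℤ :+ con (+ 3) :* s)) :- con (+ 16) :* F :=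
                    (δ :* (con (+ 3) :* s :- con (+ 2))) :* (δ :* (con (+ 3) :* s :- con (+ 2)))
                        :- con (+ 16) :* F) refl δ s F) 16F≤δ²m²)
                 (trans 4n≈ (solve 4 (λ α β D σ → normᵖ 1ℤ 1ℤ -1ℤ (con -1ℤ) α β D σ :=
                    ((α :+ β) :- con 1ℤ) :* ((α :+ β) :* (α :+ β) :+ Fᵖ D σ)) refl α β D σ))
                 -- The complex trace -s is negative, so it does not vanish along with the value s -
                 -- 1; together they give the full trace -1.
                 λ s-1≈0 → Neg⇒≉0 (Pos-resp-≈ (solve 2 (λ α β →
                     α :+ β :=
                         :- (:- (con 1ℤ :* (con -1ℤ :+ α) :+ con 1ℤ :* (con -1ℤ :+ β))
                         :+ con (+ 2) :* con -1ℤ)) refl α β) 0<s)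
                   (value≈0⇒trace≈0
                       (trans (solve 2 (λ α β → con 1ℤ :* α :+ con 1ℤ :* β :+ con -1ℤ :=
                       (α :+ β) :- con 1ℤ) refl α β) s-1≈0))

          opposite-orientation-2 : b ≡ -[1+ 1 ] → ⊥
          opposite-orientation-2 ≡.refl =
            let n , 4n≈ , value≈0⇒trace≈0 = β-norm -1ℤ -1ℤ 1ℤ
            in shifted-sum-norm n {int (+ 2) - s} {δ} {F} s<2 2-s<2 δ²≤[2-[2-s]]² (E≥0 (- σ))
                 (≥0-resp-≈ (solve 3 (λ δ s F →
                    (δ :* (con (+ 2) :* con -[1+ 1 ] :+ con (+ 3) :* s))
                        :* (δ :* (con (+ 2) :* con -[1+ 1 ] :+ con (+ 3) :* s))
                        :- con (+ 16) :* F :=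
                    (δ :* (con (+ 3) :* (con (+ 2) :- s) :- con (+ 2)))
                        :* (δ :* (con (+ 3) :* (con (+ 2) :- s) :- con (+ 2))) :- con (+ 16) :* F)
                    refl δ s F) 16F≤δ²m²)
                 (trans 4n≈ (solve 4 (λ α β D σ → normᵖ -1ℤ -1ℤ 1ℤ (con -[1+ 1 ]) α β D σ :=
                    ((con (+ 2) :- (α :+ β)) :- con 1ℤ) :* ((con (+ 2) :- (α :+ β)) :* (con (+ 2)
                        :- (α :+ β)) :+ Fᵖ D σ)) refl α β D σ))
                 λ 1-s≈0 → Neg⇒≉0 (Pos-resp-≈ (solve 2 (λ α β →
                     con (+ 2) :- (α :+ β) :=
                         :- (:- (con -1ℤ :* (con -[1+ 1 ] :+ α) :+ con -1ℤ :* (con -[1+ 1 ] :+ β))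
                         :+ con (+ 2) :* con 1ℤ)) refl α β) s<2)
                   (value≈0⇒trace≈0
                       (trans (solve 2 (λ α β → con -1ℤ :* α :+ con -1ℤ :* β :+ con 1ℤ :=
                       (con (+ 2) :- (α :+ β)) :- con 1ℤ) refl α β) 1-s≈0))

          opposite-orientation : ∀ i → b ≡ i → ℤ.- (+ 3) ℤ.≤ i → i ℤ.≤ 0ℤ → ⊥
          opposite-orientation (+ zero)                   b≡i _ _ = opposite-orientation-0 b≡i
          opposite-orientation (+ suc _)                  _ _ (+≤+ ())
          opposite-orientation -[1+ 0 ]                   b≡i _ _ = opposite-orientation-1 b≡i
          opposite-orientation -[1+ 1 ]                   b≡i _ _ = opposite-orientation-2 b≡i
          opposite-orientation -[1+ 2 ]                   b≡i _ _ = opposite-orientation-3 b≡i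
          opposite-orientation -[1+ suc (suc (suc _)) ]   _ (-≤- (ℕ.s≤s (ℕ.s≤s ()))) _

        α≈β : ¬ ¬ α ≈ β
        α≈β α≉β = by-sign σ
          (λ 0<σ → same-orientation 0<σ λ δ≈0 → α≉β (x-y≈0⇒x≈y δ≈0))
          (im≉0 t∈ gβ≈0 (integral⊆rational (ℤ-sub.int∈ e)) β∉ℚ)
          (λ σ<0 → opposite-orientation σ<0 b ≡.refl -3≤b b≤0)

    -- Quantifying over subfields S keeps ℚ⟨_⟩, which lives in ℂ, out of the abstract setting.
    no-common-field : ∀ {d e α β} → Pos α → Pos (int 1ℤ - α) → Pos β → Pos (int 1ℤ - β) →
      α ^ 3 + int b * α ^ 2 + int c * α + int d ≈ 0# →
      β ^ 3 + int b * β ^ 2 + int c * β + int e ≈ 0# →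
      (∀ (S : Pred Carrier 0ℓ) → IsSubring S → (∀ {x y} → S x → x * y ≈ 1# → S y) → S α → S β) →
      ¬ ¬ α ≈ β
    no-common-field {d} {e} {α} {β} 0<α α<1 0<β β<1 fα≈0 gβ≈0 β∈ α≉β =
      irrationalRoot {d} 0<α α<1 (trans (sym (as-cubic d α)) fα≈0) λ α-root →
      irrationalRoot {e} 0<β β<1 (trans (sym (as-cubic e β)) gβ≈0) λ β-root →
      let open CubicField α-root
          t , t∈ , t≈β = β∈ ℚ[α] ℚ[α]-isSubring ℚ[α]-inverse α∈ℚ[α]
      in TwoRoots.α≈β {d} {e} α-root {t} t∈
           (trans (cubic-cong t≈β) (IrrationalRoot.fα≈0 β-root))
           (λ t∈ℚ → IrrationalRoot.α∉ℚ β-root (IsSubring.resp-≈ rational-isSubring t≈β t∈ℚ))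
           0<α α<1 (Pos-resp-≈ (sym t≈β) 0<β) (Pos-resp-≈ (+-congˡ (-‿cong (sym t≈β))) β<1)
           λ α≈t → α≉β (trans α≈t t≈β)
      where
      as-cubic : ∀ d x → x ^ 3 + int b * x ^ 2 + int c * x + int d ≈ cubic (int b) (int c) (int d) x
      as-cubic d x = solve 4 (λ b c d x → x :^ 3 :+ b :* x :^ 2 :+ c :* x :+ d := cubicᵖ b c d x)
        refl (int b) (int c) (int d) x

-- The ordered field of real numbers

open import Defs
open +-*-Solver using (solve; _:+_; _:*_; :-_; _:-_; _:=_; con)

Null : (ℕ → ℚ) → Set
Null f = ∀ ε → 0ℚ ℚ.< ε → ∃[ N ] (∀ n → N ℕ.≤ n → ∣ f n ∣ ℚ.< ε)

Null-cong : ∀ {f g} → (∀ n → f n ≡ g n) → Null f → Null g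
Null-cong f≡g f-null ε 0<ε =
  let N , small = f-null ε 0<ε
  in N , λ n N≤n → subst (λ q → ∣ q ∣ ℚ.< ε) (f≡g n) (small n N≤n)

0<½ε : ∀ {ε} → 0ℚ ℚ.< ε → 0ℚ ℚ.< ½ ℚ.* ε
0<½ε {ε} 0<ε = subst (ℚ._< ½ ℚ.* ε) (ℚ.*-zeroʳ ½) (ℚ.*-monoʳ-<-pos ½ 0<ε)

½ε+½ε≡ε : ∀ ε → ½ ℚ.* ε ℚ.+ ½ ℚ.* ε ≡ ε
½ε+½ε≡ε = solve 1 (λ e → con ½ :* e :+ con ½ :* e := e) ≡.refl

Null-+ : ∀ {f g} → Null f → Null g → Null (λ n → f n ℚ.+ g n)
Null-+ {f} {g} f-null g-null ε 0<ε =
  let M , f-small = f-null (½ ℚ.* ε) (0<½ε 0<ε)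
      N , g-small = g-null (½ ℚ.* ε) (0<½ε 0<ε)
  in M ℕ.⊔ N , λ n ≤n → ℚ.≤-<-trans (ℚ.∣p+q∣≤∣p∣+∣q∣ (f n) (g n))
    (subst (∣ f n ∣ ℚ.+ ∣ g n ∣ ℚ.<_) (½ε+½ε≡ε ε)
      (ℚ.+-mono-< (f-small n (ℕ.m⊔n≤o⇒m≤o M N ≤n)) (g-small n (ℕ.m⊔n≤o⇒n≤o M N ≤n))))

Null-neg : ∀ {f} → Null f → Null (λ n → ℚ.- f n)
Null-neg {f} f-null ε 0<ε =
  let N , small = f-null ε 0<ε
  in N , λ n N≤n → subst (ℚ._< ε) (≡.sym (ℚ.∣-p∣≡∣p∣ (f n))) (small n N≤n)

Null-* : ∀ (f : ℕ → ℚ) {g} (B : ℚ) → .{{Positive B}} → ∃[ M ] (∀ n → M ℕ.≤ n → ∣ f n ∣ ℚ.≤ B) →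
         Null g → Null (λ n → f n ℚ.* g n)
Null-* f {g} B (M , f≤B) g-null ε 0<ε =
  let N , g-small = g-null (1/B ℚ.* ε)
        (subst (ℚ._< 1/B ℚ.* ε) (ℚ.*-zeroʳ 1/B) (ℚ.*-monoʳ-<-pos 1/B {{ℚ.1/pos⇒pos B}} 0<ε))
  in M ℕ.⊔ N , λ n ≤n → begin-strict
    ∣ f n ℚ.* g n ∣       ≡⟨ ℚ.∣p*q∣≡∣p∣*∣q∣ (f n) (g n) ⟩
    ∣ f n ∣ ℚ.* ∣ g n ∣
      ≤⟨ ℚ.*-monoʳ-≤-nonNeg ∣ g n ∣ {{ℚ.∣-∣-nonNeg (g n)}} (f≤B n (ℕ.m⊔n≤o⇒m≤o M N ≤n)) ⟩
    B ℚ.* ∣ g n ∣         <⟨ ℚ.*-monoʳ-<-pos B (g-small n (ℕ.m⊔n≤o⇒n≤o M N ≤n)) ⟩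
    B ℚ.* (1/B ℚ.* ε)     ≡⟨ ℚ.*-assoc B 1/B ε ⟨
    B ℚ.* 1/B ℚ.* ε       ≡⟨ cong (ℚ._* ε) (ℚ.*-inverseʳ B {{ℚ.pos⇒nonZero B}}) ⟩
    1ℚ ℚ.* ε              ≡⟨ ℚ.*-identityˡ ε ⟩
    ε                     ∎
  where
  open ℚ.≤-Reasoning
  1/B : ℚ
  1/B = (ℚ.1/ B) {{ℚ.pos⇒nonZero B}}

eventually-bounded : ∀ x → ∃[ B ] (Positive B × ∃[ N ] (∀ n → N ℕ.≤ n → ∣ seq x n ∣ ℚ.≤ B))
eventually-bounded x =
  let N , close = cauchy x 1ℚ (ℚ.positive⁻¹ 1ℚ)
  in 1ℚ ℚ.+ ∣ seq x N ∣
   , ℚ.pos+nonNeg⇒pos 1ℚ ∣ seq x N ∣ {{ℚ.∣-∣-nonNeg (seq x N)}}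
   , N
   , λ n N≤n → begin
    ∣ seq x n ∣                                ≡⟨ cong ∣_∣ (split (seq x n) (seq x N)) ⟩
    ∣ (seq x n ℚ.- seq x N) ℚ.+ seq x N ∣      ≤⟨ ℚ.∣p+q∣≤∣p∣+∣q∣ (seq x n ℚ.- seq x N) (seq x N) ⟩
    ∣ seq x n ℚ.- seq x N ∣ ℚ.+ ∣ seq x N ∣
      ≤⟨ ℚ.+-monoˡ-≤ ∣ seq x N ∣ (ℚ.<⇒≤ (close n N N≤n ℕ.≤-refl)) ⟩
    1ℚ ℚ.+ ∣ seq x N ∣                         ∎
  where
  open ℚ.≤-Reasoning
  split : ∀ p q → p ≡ (p ℚ.- q) ℚ.+ q
  split = solve 2 (λ p q → p := (p :- q) :+ q) ≡.refl

≡⇒≈ : ∀ x y → (∀ n → seq x n ≡ seq y n) → x ≈ y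
≡⇒≈ x y x≡y ε 0<ε = 0 , λ n _ → subst (ℚ._< ε)
  (cong ∣_∣ (≡.trans (≡.sym (ℚ.+-inverseʳ (seq y n))) (cong (ℚ._- seq y n) (≡.sym (x≡y n))))) 0<ε

≈-refl : ∀ {x} → x ≈ x
≈-refl {x} = ≡⇒≈ x x λ _ → ≡.refl

≈-sym : ∀ {x y} → x ≈ y → y ≈ x
≈-sym {x} {y} x≈y = Null-cong (λ n → swap (seq x n) (seq y n)) (Null-neg x≈y)
  where
  swap : ∀ p q → ℚ.- (p ℚ.- q) ≡ q ℚ.- p
  swap = solve 2 (λ p q → :- (p :- q) := q :- p) ≡.refl

≈-trans : ∀ {x y z} → x ≈ y → y ≈ z → x ≈ z
≈-trans {x} {y} {z} x≈y y≈z =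
  Null-cong (λ n → telescope (seq x n) (seq y n) (seq z n)) (Null-+ x≈y y≈z)
  where
  telescope : ∀ p q r → (p ℚ.- q) ℚ.+ (q ℚ.- r) ≡ p ℚ.- r
  telescope = solve 3 (λ p q r → (p :- q) :+ (q :- r) := p :- r) ≡.refl

+-cong : ∀ {x y u v} → x ≈ y → u ≈ v → x + u ≈ y + v
+-cong {x} {y} {u} {v} x≈y u≈v =
  Null-cong (λ n → regroup (seq x n) (seq y n) (seq u n) (seq v n)) (Null-+ x≈y u≈v)
  where
  regroup : ∀ p q r s → (p ℚ.- q) ℚ.+ (r ℚ.- s) ≡ (p ℚ.+ r) ℚ.- (q ℚ.+ s)
  regroup = solve 4 (λ p q r s → (p :- q) :+ (r :- s) := (p :+ r) :- (q :+ s)) ≡.refl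

-‿cong : ∀ {x y} → x ≈ y → - x ≈ - y
-‿cong {x} {y} x≈y = Null-cong (λ n → ℚ.neg-distrib-+ (seq x n) (ℚ.- seq y n)) (Null-neg x≈y)

*-cong : ∀ {x y u v} → x ≈ y → u ≈ v → x * u ≈ y * v
*-cong {x} {y} {u} {v} x≈y u≈v =
  let A , A-pos , x≤A = eventually-bounded x
      B , B-pos , v≤B = eventually-bounded v
  in Null-cong (λ n → regroup (seq x n) (seq y n) (seq u n) (seq v n))
       (Null-+ {f = λ n → seq x n ℚ.* (seq u n ℚ.- seq v n)}
         (Null-* (seq x) A {{A-pos}} x≤A u≈v) (Null-* (seq v) B {{B-pos}} v≤B x≈y))
  where
  regroup : ∀ p q r s → p ℚ.* (r ℚ.- s) ℚ.+ s ℚ.* (p ℚ.- q) ≡ p ℚ.* r ℚ.- q ℚ.* s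
  regroup = solve 4 (λ p q r s → p :* (r :- s) :+ s :* (p :- q) := p :* r :- q :* s) ≡.refl

ℝ-commutativeRing : CommutativeRing 0ℓ 0ℓ
ℝ-commutativeRing = record
  { Carrier = ℝ ; _≈_ = _≈_ ; _+_ = _+_ ; _*_ = _*_ ; -_ = -_ ; 0# = 0ℝ ; 1# = 1ℝ
  ; isCommutativeRing = record
    { isRing = record
      { +-isAbelianGroup = record
        { isGroup = record
          { isMonoid = record
            { isSemigroup = record
              { isMagma = record
                { isEquivalence = record
                  { refl = λ {x} → ≈-refl {x}
                  ; sym = λ {x} {y} → ≈-sym {x} {y}
                  ; trans = λ {x} {y} {z} → ≈-trans {x} {y} {z}
                  }
                ; ∙-cong = λ {x} {y} {u} {v} → +-cong {x} {y} {u} {v}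
                }
              ; assoc = λ x y z → ≡⇒≈ (x + y + z) (x + (y + z)) λ n → ℚ.+-assoc (seq x n) (seq y n)
                  (seq z n)
              }
            ; identity = (λ x → ≡⇒≈ (0ℝ + x) x λ n → ℚ.+-identityˡ (seq x n))
                       , (λ x → ≡⇒≈ (x + 0ℝ) x λ n → ℚ.+-identityʳ (seq x n))
            }
          ; inverse = (λ x → ≡⇒≈ (- x + x) 0ℝ λ n → ℚ.+-inverseˡ (seq x n))
                    , (λ x → ≡⇒≈ (x + - x) 0ℝ λ n → ℚ.+-inverseʳ (seq x n))
          ; ⁻¹-cong = λ {x} {y} → -‿cong {x} {y}
          }
        ; comm = λ x y → ≡⇒≈ (x + y) (y + x) λ n → ℚ.+-comm (seq x n) (seq y n)
        }
      ; *-cong = λ {x} {y} {u} {v} → *-cong {x} {y} {u} {v}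
      ; *-assoc = λ x y z → ≡⇒≈ (x * y * z) (x * (y * z)) λ n → ℚ.*-assoc (seq x n) (seq y n)
          (seq z n)
      ; *-identity = (λ x → ≡⇒≈ (1ℝ * x) x λ n → ℚ.*-identityˡ (seq x n))
                   , (λ x → ≡⇒≈ (x * 1ℝ) x λ n → ℚ.*-identityʳ (seq x n))
      ; distrib = (λ x y z → ≡⇒≈ (x * (y + z)) (x * y + x * z) λ n → ℚ.*-distribˡ-+ (seq x n)
          (seq y n) (seq z n))
                , (λ x y z → ≡⇒≈ ((y + z) * x) (y * x + z * x) λ n → ℚ.*-distribʳ-+ (seq x n)
                    (seq y n) (seq z n))
      }
    ; *-comm = λ x y → ≡⇒≈ (x * y) (y * x) λ n → ℚ.*-comm (seq x n) (seq y n)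
    }
  }

-- Positivity of real numbers

private
  gap⇒pos : ∀ x ε N → 0ℚ ℚ.< ε → (∀ n → N ℕ.≤ n → ε ℚ.< seq x n) → 0ℝ < x
  gap⇒pos x ε N 0<ε lower = ε , 0<ε , N , λ n N≤n →
    subst (ℚ._< seq x n) (≡.sym (ℚ.+-identityˡ ε)) (lower n N≤n)

  pos⇒gap : ∀ x → 0ℝ < x → ∃[ ε ] (0ℚ ℚ.< ε × ∃[ N ] (∀ n → N ℕ.≤ n → ε ℚ.< seq x n))
  pos⇒gap x (ε , 0<ε , N , lower) = ε , 0<ε , N , λ n N≤n →
    subst (ℚ._< seq x n) (ℚ.+-identityˡ ε) (lower n N≤n)

p≤∣p∣ : ∀ p → p ℚ.≤ ∣ p ∣
p≤∣p∣ p with ℚ.≤-total 0ℚ p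
... | inj₁ 0≤p = ℚ.≤-reflexive (≡.sym (ℚ.0≤p⇒∣p∣≡p 0≤p))
... | inj₂ p≤0 = ℚ.≤-trans p≤0 (ℚ.0≤∣p∣ p)

-p≤∣p∣ : ∀ p → ℚ.- p ℚ.≤ ∣ p ∣
-p≤∣p∣ p = subst (ℚ.- p ℚ.≤_) (ℚ.∣-p∣≡∣p∣ p) (p≤∣p∣ (ℚ.- p))

0<-resp-≈ : ∀ {x y} → x ≈ y → 0ℝ < x → 0ℝ < y
0<-resp-≈ {x} {y} x≈y 0<x =
  let ε , 0<ε , M , lower = pos⇒gap x 0<x
      N , close = x≈y (½ ℚ.* ε) (0<½ε 0<ε)
  in gap⇒pos y (½ ℚ.* ε) (M ℕ.⊔ N) (0<½ε 0<ε) λ n ≤n →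
    subst₂ ℚ._<_ (left ε) (right (seq x n) (seq y n))
      (ℚ.+-mono-< (lower n (ℕ.m⊔n≤o⇒m≤o M N ≤n))
        (ℚ.neg-antimono-< (ℚ.≤-<-trans (p≤∣p∣ (seq x n ℚ.- seq y n))
            (close n (ℕ.m⊔n≤o⇒n≤o M N ≤n)))))
  where
  left : ∀ e → e ℚ.+ ℚ.- (½ ℚ.* e) ≡ ½ ℚ.* e
  left = solve 1 (λ e → e :+ :- (con ½ :* e) := con ½ :* e) ≡.refl
  right : ∀ p q → p ℚ.+ ℚ.- (p ℚ.- q) ≡ q
  right = solve 2 (λ p q → p :+ :- (p :- q) := q) ≡.refl

0<-+ : ∀ {x y} → 0ℝ < x → 0ℝ < y → 0ℝ < x + y
0<-+ {x} {y} 0<x 0<y =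
  let ε , 0<ε , M , x-lower = pos⇒gap x 0<x
      η , 0<η , N , y-lower = pos⇒gap y 0<y
  in gap⇒pos (x + y) (ε ℚ.+ η) (M ℕ.⊔ N) (ℚ.+-mono-< 0<ε 0<η) λ n ≤n →
    ℚ.+-mono-< (x-lower n (ℕ.m⊔n≤o⇒m≤o M N ≤n)) (y-lower n (ℕ.m⊔n≤o⇒n≤o M N ≤n))

0<-* : ∀ {x y} → 0ℝ < x → 0ℝ < y → 0ℝ < x * y
0<-* {x} {y} 0<x 0<y =
  let ε , 0<ε , M , x-lower = pos⇒gap x 0<x
      η , 0<η , N , y-lower = pos⇒gap y 0<y
      ε-pos = ℚ.positive 0<ε
      η-pos = ℚ.positive 0<η
  in gap⇒pos (x * y) (ε ℚ.* η) (M ℕ.⊔ N)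
       (ℚ.positive⁻¹ (ε ℚ.* η) {{ℚ.pos*pos⇒pos ε {{ε-pos}} η {{η-pos}}}}) λ n ≤n →
    ℚ.<-trans (ℚ.*-monoʳ-<-pos ε {{ε-pos}} (y-lower n (ℕ.m⊔n≤o⇒n≤o M N ≤n)))
      (ℚ.*-monoˡ-<-pos (seq y n)
        {{ℚ.positive (ℚ.<-trans 0<η (y-lower n (ℕ.m⊔n≤o⇒n≤o M N ≤n)))}}
        (x-lower n (ℕ.m⊔n≤o⇒m≤o M N ≤n)))

0≮0 : ¬ 0ℝ < 0ℝ
0≮0 0<0 = let ε , 0<ε , N , lower = pos⇒gap 0ℝ 0<0
          in ℚ.<-irrefl ≡.refl (ℚ.<-trans 0<ε (lower N ℕ.≤-refl))

fromℚ-pos : ∀ {q} → 0ℚ ℚ.< q → 0ℝ < fromℚ q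
-- The gap has to stay strictly below the constant term q, hence one half of q.
fromℚ-pos {q} 0<q = gap⇒pos (fromℚ q) (½ ℚ.* q) 0 (0<½ε 0<q) λ _ _ →
  subst₂ ℚ._<_ (ℚ.+-identityʳ (½ ℚ.* q)) (½ε+½ε≡ε q) (ℚ.+-monoʳ-< (½ ℚ.* q) (0<½ε 0<q))

-- If a late term is at least ε/2 in absolute value, then x is bounded away
-- from 0 by ε/4, since later terms move by less than ε/4.
0<-connex : ∀ {x} → ¬ 0ℝ < x → ¬ 0ℝ < - x → x ≈ 0ℝ
0<-connex {x} x≯0 x≮0 ε 0<ε = N , λ n N≤n →
  subst (λ q → ∣ q ∣ ℚ.< ε) (shift (seq x n) (seq x N))
    (ℚ.≤-<-trans (ℚ.∣p+q∣≤∣p∣+∣q∣ (seq x n ℚ.- seq x N) (seq x N))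
      (subst (∣ seq x n ℚ.- seq x N ∣ ℚ.+ ∣ seq x N ∣ ℚ.<_) (½ε+½ε≡ε ε)
        (ℚ.+-mono-< (ℚ.<-trans (close n N N≤n ℕ.≤-refl) ½η<η) small)))
  where
  η : ℚ
  η = ½ ℚ.* ε

  0<η : 0ℚ ℚ.< η
  0<η = 0<½ε 0<ε

  ½η<η : ½ ℚ.* η ℚ.< η
  ½η<η = subst₂ ℚ._<_ (ℚ.+-identityʳ (½ ℚ.* η)) (½ε+½ε≡ε η) (ℚ.+-monoʳ-< (½ ℚ.* η) (0<½ε 0<η))

  N : ℕ
  N = proj₁ (cauchy x (½ ℚ.* η) (0<½ε 0<η))

  close : ∀ m n → N ℕ.≤ m → N ℕ.≤ n → ∣ seq x m ℚ.- seq x n ∣ ℚ.< ½ ℚ.* η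
  close = proj₂ (cauchy x (½ ℚ.* η) (0<½ε 0<η))

  shift : ∀ p q → (p ℚ.- q) ℚ.+ q ≡ p ℚ.- 0ℚ
  shift = solve 2 (λ p q → (p :- q) :+ q := p :- con 0ℚ) ≡.refl

  far : ∀ y → (∀ n → N ℕ.≤ n → seq y N ℚ.- seq y n ℚ.< ½ ℚ.* η) → η ℚ.≤ seq y N → 0ℝ < y
  far y near η≤y = gap⇒pos y (½ ℚ.* η) N (0<½ε 0<η) λ n N≤n →
    subst₂ ℚ._<_ (left η) (right (seq y N) (seq y n))
      (ℚ.+-mono-≤-< η≤y (ℚ.neg-antimono-< (near n N≤n)))
    where
    left : ∀ e → e ℚ.+ ℚ.- (½ ℚ.* e) ≡ ½ ℚ.* e
    left = solve 1 (λ e → e :+ :- (con ½ :* e) := con ½ :* e) ≡.refl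
    right : ∀ p q → p ℚ.+ ℚ.- (p ℚ.- q) ≡ q
    right = solve 2 (λ p q → p :+ :- (p :- q) := q) ≡.refl

  small : ∣ seq x N ∣ ℚ.< η
  small with ∣ seq x N ∣ ℚ.<? η | ℚ.∣p∣≡p∨∣p∣≡-p (seq x N)
  ... | yes lt | _ = lt
  ... | no ≮ | inj₁ eq = contradiction
    (far x (λ n N≤n → ℚ.≤-<-trans (p≤∣p∣ _) (close N n ℕ.≤-refl N≤n))
      (subst (η ℚ.≤_) eq (ℚ.≮⇒≥ ≮))) x≯0
  ... | no ≮ | inj₂ eq = contradiction
    (far (- x) (λ n N≤n → ℚ.≤-<-trans
        (subst (ℚ._≤ ∣ seq x N ℚ.- seq x n ∣) (ℚ.neg-distrib-+ (seq x N) (ℚ.- seq x n)) (-p≤∣p∣ _))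
        (close N n ℕ.≤-refl N≤n))
      (subst (η ℚ.≤_) eq (ℚ.≮⇒≥ ≮))) x≮0

x<y⇒0<y-x : ∀ {x y} → x < y → 0ℝ < y + - x
x<y⇒0<y-x {x} {y} (ε , 0<ε , N , gap) = gap⇒pos (y + - x) ε N 0<ε λ n N≤n →
  subst (ℚ._< seq y n ℚ.- seq x n) (cancel (seq x n) ε) (ℚ.+-monoˡ-< (ℚ.- seq x n) (gap n N≤n))
  where
  cancel : ∀ p q → p ℚ.+ q ℚ.- p ≡ q
  cancel = solve 2 (λ p q → p :+ q :- p := q) ≡.refl

ℝ-orderedℚAlgebra : OrderedℚAlgebra
ℝ-orderedℚAlgebra = record
  { commutativeRing = ℝ-commutativeRing
  ; Pos        = 0ℝ <_
  ; Pos-resp-≈ = λ {x} {y} → 0<-resp-≈ {x} {y}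
  ; Pos-+      = λ {x} {y} → 0<-+ {x} {y}
  ; Pos-*      = λ {x} {y} → 0<-* {x} {y}
  ; ¬Pos-0     = 0≮0
  ; Pos-connex = λ {x} → 0<-connex {x}
  ; ι          = fromℚ
  ; ι-+        = λ p q → ≈-refl {fromℚ (p ℚ.+ q)}
  ; ι-*        = λ p q → ≈-refl {fromℚ (p ℚ.* q)}
  ; ι-neg      = λ p → ≈-refl {fromℚ (ℚ.- p)}
  ; ι-0        = ≈-refl {0ℝ}
  ; ι-1        = ≈-refl {1ℝ}
  ; ι-pos      = fromℚ-pos
  }

module Real = Theory ℝ-orderedℚAlgebra

-- Subfields of ℂ generated by a real number

module _ (S : Pred ℝ 0ℓ) (S-isSubring : Real.IsSubring S)
         (S-inverse : ∀ {x y} → S x → x * y ≈ 1ℝ → S y) where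
  open Real.IsSubring S-isSubring

  -- Induction over the generation of the subfield. Carrying along that imaginary parts vanish is
  -- what makes products and inverses reduce to their real parts, so that the closure properties of
  -- S apply.
  ℚ⟨⟩⊆real-subfield : ∀ {α z} → S α → ℚ⟨ fromℝ α ⟩ z → S (re z) × im z ≈ 0ℝ
  ℚ⟨⟩⊆real-subfield α∈ generator = α∈ , ≈-refl {0ℝ}
  ℚ⟨⟩⊆real-subfield α∈ zero      = 0∈ , ≈-refl {0ℝ}
  ℚ⟨⟩⊆real-subfield α∈ one       = 1∈ , ≈-refl {0ℝ}
  ℚ⟨⟩⊆real-subfield α∈ (add {z} {w} z∈ w∈) =
    let re-z , im-z = ℚ⟨⟩⊆real-subfield α∈ z∈
        re-w , im-w = ℚ⟨⟩⊆real-subfield α∈ w∈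
    in +∈ re-z re-w , Real.≈0-+ {im z} {im w} im-z im-w
  ℚ⟨⟩⊆real-subfield α∈ (negate {z} z∈) =
    let re-z , im-z = ℚ⟨⟩⊆real-subfield α∈ z∈
    in -∈ re-z , Real.≈0-neg {im z} im-z
  ℚ⟨⟩⊆real-subfield α∈ (multiply {z} {w} z∈ w∈) =
    let re-z , im-z = ℚ⟨⟩⊆real-subfield α∈ z∈
        re-w , im-w = ℚ⟨⟩⊆real-subfield α∈ w∈
    in resp-≈ (≈-sym {re z * re w + - (im z * im w)} {re z * re w}
                 (Real.real-product (re z) (re w) {im z} (im w) im-z))
              (*∈ re-z re-w)
     , Real.imaginary-product (re z) (re w) {im z} {im w} im-z im-w
  ℚ⟨⟩⊆real-subfield α∈ (invert {z} {w} z∈ (re-zw , im-zw)) =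
    let re-z , im-z = ℚ⟨⟩⊆real-subfield α∈ z∈
    in S-inverse re-z (≈-trans {re z * re w} {re z * re w + - (im z * im w)} {1ℝ}
         (≈-sym {re z * re w + - (im z * im w)} {re z * re w}
           (Real.real-product (re z) (re w) {im z} (im w) im-z)) re-zw)
     , Real.imaginary-inverse (re z) (re w) {im z} {im w} im-z re-zw im-zw
  ℚ⟨⟩⊆real-subfield α∈ (respects {z} {w} (re≈ , im≈) z∈) =
    let re-z , im-z = ℚ⟨⟩⊆real-subfield α∈ z∈
    in resp-≈ re≈ re-z , ≈-trans {im w} {im z} {0ℝ} (≈-sym {im z} {im w} im≈) im-z

theorem11 : (b c : ℤ) → ℤ.- (+ 3) ℤ.≤ b → b ℤ.≤ 0ℤ → c ℤ.≥ ℤ.- b ℤ.+ 1ℤ →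
    (α β : ℝ) → α ∈ I³ⁿᵗʳ b c → β ∈ I³ⁿᵗʳ b c → α ≉ β →
    ¬ (ℚ⟨ fromℝ α ⟩ ≐ ℚ⟨ fromℝ β ⟩)
theorem11 b c -3≤b b≤0 1-b≤c α β
  ((0<α , α<1) , d , _ , _ , fα≈0) ((0<β , β<1) , e , _ , _ , gβ≈0) α≉β (_ , ℚ⟨β⟩⊆ℚ⟨α⟩) =
  Real.no-common-field {b} {c} -3≤b b≤0 1-b≤c {d} {e} {α} {β}
    0<α (x<y⇒0<y-x {α} {1ℝ} α<1) 0<β (x<y⇒0<y-x {β} {1ℝ} β<1) fα≈0 gβ≈0
    (λ S S-isSubring S-inverse α∈ →
      proj₁ (ℚ⟨⟩⊆real-subfield S S-isSubring (λ {x} {y} → S-inverse {x} {y}) α∈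
          (ℚ⟨β⟩⊆ℚ⟨α⟩ generator)))
    α≉β
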